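{- Write $\Delta_2=\prod_{i=1}^\infty(1-2^{ -i})$. Then, as $n\to\infty$, \[ \mathrm{La}(n,O_6)\ \ge\ \left(1+c+o(1)\right)\binom n{\lfloor n/2\rfloor}, \] where \[ c=\Delta_2\sum_{j=1}^{\infty}\frac{2^{ -j}}{\left(\prod_{i=1}^{j-1}(2^i-1)\right)^2}>0.22 \] (the empty product, for $j=1$, equals $1$).
   Context: A family $\mathcal G$ of sets is a weak copy of a finite poset $(P,\leqslant)$ if there is a bijection $\psi:P\to\mathcal G$ such that $\psi(p)\subseteq\psi(p')$ whenever $p\leqslant p'$. A family $\mathcal F$ is (weak) $P$-free if no subfamily of it is a weak copy of $P$. $\mathrm{La}(n,P)$ is the maximum size of a weak $P$-free family $\mathcal F\subseteq 2^{[n]}$, where $[n]=\{1,\dots,n\}$ and $2^{[n]}$ is the family of all subsets of $[n]$. The crown poset $O_6$ has six elements $a_1,a_2,a_3,b_{12},b_{13},b_{23}$, whose only strict relations are $a_i<b_{rs}$ if and only if $i\in\{r,s\}$. -}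

module Defs where

open import Data.Bool.Base using (Bool; true; false)
open import Data.Empty using (⊥-elim)
open import Data.Fin.Base using (Fin; zero; suc; combine)
open import Data.Fin.Patterns using (0F; 1F; 2F; 3F; 4F; 5F)
import Data.Fin.Properties as Fin
open import Data.Fin.Subset using (Subset; _⊆_)
open import Data.Fin.Subset.Properties using (anySubset?; _⊆?_)
open import Data.Integer.Base as ℤ using (+_)
import Data.Integer.Properties as ℤ
open import Data.List.Base as List using (List; []; _∷_; length)
open import Data.List.Membership.Propositional using (_∈_)
open import Data.List.Membership.Propositional.Properties
  using (∈-tabulate⁺; ∈-tabulate⁻; ∈-lookup)
open import Data.List.Membership.Propositional.Properties.WithK
  using (unique⇒irrelevant)
open import Data.List.Relation.Unary.All as All using ([]; _∷_)
open import Data.List.Relation.Unary.AllPairs using ([]; _∷_)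
open import Data.List.Relation.Unary.Unique.Propositional using (Unique)
import Data.List.Relation.Unary.Unique.DecPropositional as DecUnique
import Data.List.Relation.Unary.Unique.Propositional.Properties as Unique
import Data.List.Membership.DecPropositional as DecMembership
open import Data.Nat.Base as ℕ using (ℕ; zero; suc; pred)
import Data.Nat.Properties as ℕ
open import Data.Product.Base using (∃; ∃-syntax; Σ-syntax; _×_; _,_; proj₁; proj₂)
open import Data.Product.Properties using (Σ-≡,≡→≡)
open import Data.Rational.Base as ℚ
  using (ℚ; 0ℚ; 1ℚ; _/_; _+_; _*_; -_; _-_; ∣_∣; _≤_; _<_)
import Data.Rational.Properties as ℚ
open import Data.Rational.Solver using (module +-*-Solver)
import Data.Rational.Unnormalised.Base as ℚᵘ
import Data.Rational.Unnormalised.Properties as ℚᵘ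
open import Data.Sum.Base using (inj₁; inj₂)
open import Data.Vec.Base as Vec using (Vec; []; _∷_)
import Data.Vec.Properties as Vec
import Data.Bool.Properties as Bool
open import Function.Base using (_∘_)
open import Function.Bundles using (_⤖_; _↔_; mk⤖; mk↔ₛ′; module Bijection; module Inverse)
open import Function.Properties.Inverse using (↔⇒↣)
import Relation.Binary.Construct.StrictToNonStrict as StrictToNonStrict
open import Relation.Binary.Definitions using (DecidableEquality)
open import Relation.Binary.PropositionalEquality
open import Relation.Binary.Structures
  using (IsDecPartialOrder; IsStrictPartialOrder)
open import Relation.Nullary using (Dec; yes; no; ¬_)
open import Relation.Nullary.Decidable using (map′; ¬?; _×-dec_; _→-dec_)
open import Relation.Unary using (Decidable)

record FinitePoset : Set₁ where
  field
    Carrier           : Set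
    _≼_               : Carrier → Carrier → Set
    isDecPartialOrder : IsDecPartialOrder _≡_ _≼_
    size              : ℕ
    enumeration       : Carrier ↔ Fin size

record Family (n : ℕ) : Set where
  constructor family
  field
    sets   : List (Subset n)
    unique : Unique sets

  ∣_∣ᶠ : ℕ
  ∣_∣ᶠ = length sets

open Family public using (∣_∣ᶠ)

private
  variable
    n : ℕ

infix 4 _∈ᶠ_ _⊆ᶠ_

_∈ᶠ_ : Subset n → Family n → Set
A ∈ᶠ 𝓕 = A ∈ Family.sets 𝓕

_⊆ᶠ_ : Family n → Family n → Set
𝓖 ⊆ᶠ 𝓕 = ∀ {A} → A ∈ᶠ 𝓖 → A ∈ᶠ 𝓕

-- The sets of a family are distinct, so membership proofs are unique and a
-- bijection onto ∃ (_∈ᶠ 𝓖) is a bijection onto the sets of 𝓖.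
IsWeakCopy : FinitePoset → Family n → Set
IsWeakCopy P 𝓖 =
  Σ[ ψ ∈ Carrier ⤖ ∃ (_∈ᶠ 𝓖) ]
    ∀ {p q} → p ≼ q → proj₁ (Bijection.to ψ p) ⊆ proj₁ (Bijection.to ψ q)
  where open FinitePoset P

IsFree : FinitePoset → Family n → Set
IsFree P 𝓕 = ∀ 𝓖 → 𝓖 ⊆ᶠ 𝓕 → ¬ IsWeakCopy P 𝓖

record IsMaximum (A : ℕ → Set) (m : ℕ) : Set where
  field
    attained   : A m
    upperBound : ∀ {k} → A k → k ℕ.≤ m

FreeSize : ℕ → FinitePoset → ℕ → Set
FreeSize n P k = Σ[ 𝓕 ∈ Family n ] IsFree P 𝓕 × ∣ 𝓕 ∣ᶠ ≡ k

private

  maximum : ∀ {A : ℕ → Set} → Decidable A → A 0 →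
            ∀ B → (∀ {k} → A k → k ℕ.≤ B) → ∃ (IsMaximum A)
  maximum A? a0 zero    ub = 0 , record { attained = a0 ; upperBound = ub }
  maximum A? a0 (suc B) ub with A? (suc B)
  ... | yes a = suc B , record { attained = a ; upperBound = ub }
  ... | no ¬a = maximum A? a0 B λ {k} ak →
    ℕ.≤-pred (ℕ.≤∧≢⇒< (ub ak) λ { refl → ¬a ak })

  anyVec? : ∀ k {Q : Vec (Subset n) k → Set} → Decidable Q → Dec (∃ Q)
  anyVec? zero    Q? = map′ ([] ,_) (λ { ([] , q) → q }) (Q? [])
  anyVec? (suc k) Q? =
    map′ (λ { (A , v , q) → A ∷ v , q }) (λ { (A ∷ v , q) → A , v , q })
         (anySubset? λ A → anyVec? k λ v → Q? (A ∷ v))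

  _≟ˢ_ : DecidableEquality (Subset n)
  _≟ˢ_ = Vec.≡-dec Bool._≟_

  lookup-injective : ∀ {A : Set} {xs : List A} → Unique xs →
                     ∀ {i j} → List.lookup xs i ≡ List.lookup xs j → i ≡ j
  lookup-injective (_ ∷ _) {zero}  {zero}  _  = refl
  lookup-injective {xs = _ ∷ xs} (x∉ ∷ _) {zero} {suc j} eq =
    ⊥-elim (All.lookup x∉ (∈-lookup {xs = xs} j) eq)
  lookup-injective {xs = _ ∷ xs} (x∉ ∷ _) {suc i} {zero} eq =
    ⊥-elim (All.lookup x∉ (∈-lookup {xs = xs} i) (sym eq))
  lookup-injective (_ ∷ u) {suc i} {suc j} eq = cong suc (lookup-injective u eq)

  bit : Bool → Fin 2
  bit false = 0F
  bit true  = 1F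

  bit-injective : ∀ {a b} → bit a ≡ bit b → a ≡ b
  bit-injective {false} {false} _ = refl
  bit-injective {true}  {true}  _ = refl

  encode : Subset n → Fin (2 ℕ.^ n)
  encode []      = 0F
  encode (b ∷ A) = combine (bit b) (encode A)

  encode-injective : {A B : Subset n} → encode A ≡ encode B → A ≡ B
  encode-injective {A = []}    {[]}    _  = refl
  encode-injective {A = a ∷ A} {b ∷ B} eq
    with e₁ , e₂ ← Fin.combine-injective (bit a) (encode A) (bit b) (encode B) eq
    = cong₂ _∷_ (bit-injective e₁) (encode-injective e₂)

  ∣𝓕∣≤2^n : (𝓕 : Family n) → ∣ 𝓕 ∣ᶠ ℕ.≤ 2 ℕ.^ n
  ∣𝓕∣≤2^n (family xs u) =
    Fin.injective⇒≤ {f = encode ∘ List.lookup xs} (lookup-injective u ∘ encode-injective)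

  module _ (P : FinitePoset) where
    open FinitePoset P
    open Inverse enumeration using (to; from; strictlyInverseˡ; strictlyInverseʳ)
    private module ≼ = IsDecPartialOrder isDecPartialOrder

    CopyIn : List (Subset n) → Set
    CopyIn {n} xs = Σ[ v ∈ Vec (Subset n) size ]
        (∀ i j → Vec.lookup v i ≡ Vec.lookup v j → i ≡ j)
      × (∀ i j → from i ≼ from j → Vec.lookup v i ⊆ Vec.lookup v j)
      × (∀ i → Vec.lookup v i ∈ xs)

    copyIn? : (xs : List (Subset n)) → Dec (CopyIn xs)
    copyIn? xs = anyVec? size λ v →
            Fin.all? (λ i → Fin.all? λ j → (Vec.lookup v i ≟ˢ Vec.lookup v j) →-dec (i Fin.≟ j))
      ×-dec Fin.all? (λ i → Fin.all? λ j → (from i ≼.≤? from j) →-dec (Vec.lookup v i ⊆? Vec.lookup v j))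
      ×-dec Fin.all? (λ i → Vec.lookup v i ∈? xs)
      where open DecMembership _≟ˢ_ using (_∈?_)

    copy⇒copyIn : (𝓕 𝓖 : Family n) → 𝓖 ⊆ᶠ 𝓕 → IsWeakCopy P 𝓖 → CopyIn (Family.sets 𝓕)
    copy⇒copyIn 𝓕 𝓖 𝓖⊆𝓕 (ψ , mono) = Vec.tabulate f , inj , mon , mem
      where
      f = λ i → proj₁ (Bijection.to ψ (from i))
      lk = Vec.lookup∘tabulate f
      inj : ∀ i j → Vec.lookup (Vec.tabulate f) i ≡ Vec.lookup (Vec.tabulate f) j → i ≡ j
      inj i j eq = trans (sym (strictlyInverseˡ i)) (trans
        (cong to (Bijection.injective ψ
          (Σ-≡,≡→≡ ( trans (sym (lk i)) (trans eq (lk j))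
                   , unique⇒irrelevant (Family.unique 𝓖) _ _))))
        (strictlyInverseˡ j))
      mon : ∀ i j → from i ≼ from j → Vec.lookup (Vec.tabulate f) i ⊆ Vec.lookup (Vec.tabulate f) j
      mon i j le = subst₂ _⊆_ (sym (lk i)) (sym (lk j)) (mono le)
      mem : ∀ i → Vec.lookup (Vec.tabulate f) i ∈ Family.sets 𝓕
      mem i = subst (_∈ Family.sets 𝓕) (sym (lk i)) (𝓖⊆𝓕 (proj₂ (Bijection.to ψ (from i))))

    copyIn⇒copy : (𝓕 : Family n) → CopyIn (Family.sets 𝓕) →
                  Σ[ 𝓖 ∈ Family n ] 𝓖 ⊆ᶠ 𝓕 × IsWeakCopy P 𝓖
    copyIn⇒copy {n} 𝓕 (v , inj , mon , mem) = 𝓖 , sub , mk⤖ {to = ψ} (ψ-inj , ψ-surj) , ψ-mono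
      where
      f = Vec.lookup v
      𝓖 : Family n
      𝓖 = family (List.tabulate f) (Unique.tabulate⁺ (inj _ _))
      sub : 𝓖 ⊆ᶠ 𝓕
      sub A∈ with i , refl ← ∈-tabulate⁻ A∈ = mem i
      ψ : Carrier → ∃ (_∈ᶠ 𝓖)
      ψ p = f (to p) , ∈-tabulate⁺ (to p)
      ψ-inj : ∀ {p q} → ψ p ≡ ψ q → p ≡ q
      ψ-inj {p} {q} eq = trans (sym (strictlyInverseʳ p)) (trans
        (cong from (inj _ _ (cong proj₁ eq))) (strictlyInverseʳ q))
      ψ-surj : ∀ y → ∃[ p ] (∀ {z} → z ≡ p → ψ z ≡ y)
      ψ-surj (A , A∈) with i , refl ← ∈-tabulate⁻ A∈ = from i , λ { refl →
        Σ-≡,≡→≡ (cong f (strictlyInverseˡ i) , unique⇒irrelevant (Family.unique 𝓖) _ _) }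
      ψ-mono : ∀ {p q} → p ≼ q → f (to p) ⊆ f (to q)
      ψ-mono {p} {q} le = mon _ _
        (subst₂ _≼_ (sym (strictlyInverseʳ p)) (sym (strictlyInverseʳ q)) le)

    free? : (𝓕 : Family n) → Dec (IsFree P 𝓕)
    free? 𝓕 = map′
      (λ ¬c 𝓖 𝓖⊆𝓕 copy → ¬c (copy⇒copyIn 𝓕 𝓖 𝓖⊆𝓕 copy))
      (λ fr c → let 𝓖 , sub , copy = copyIn⇒copy 𝓕 c in fr 𝓖 sub copy)
      (¬? (copyIn? (Family.sets 𝓕)))

    freeSize? : ∀ n → Decidable (FreeSize n P)
    freeSize? n k = map′
      (λ { (v , u , fr) → family (Vec.toList v) u , fr , Vec.length-toList v })
      (λ { (family xs u , fr , refl) → Vec.fromList xs , from-list xs u fr })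
      (anyVec? k λ v → uniqueFree? (Vec.toList v))
      where
      UniqueFree : List (Subset n) → Set
      UniqueFree xs = Σ[ u ∈ Unique xs ] IsFree P (family xs u)
      uniqueFree? : ∀ xs → Dec (UniqueFree xs)
      uniqueFree? xs with DecUnique.unique? _≟ˢ_ xs
      ... | no ¬u = no (¬u ∘ proj₁)
      ... | yes u = map′ (u ,_) proj₂ (free? (family xs u))
      from-list : ∀ xs (u : Unique xs) → IsFree P (family xs u) →
                  UniqueFree (Vec.toList (Vec.fromList xs))
      from-list xs u fr = subst UniqueFree (sym (Vec.toList∘fromList xs)) (u , fr)

    ∅-free : .{{ℕ.NonZero size}} → FreeSize n P 0
    ∅-free = family [] [] , ¬copy , refl
      where
      point : ∀ {k} → .{{ℕ.NonZero k}} → Fin k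
      point {suc _} = zero
      ¬copy : IsFree P (family [] [])
      ¬copy 𝓖 𝓖⊆∅ (ψ , _) with () ← 𝓖⊆∅ (proj₂ (Bijection.to ψ (from point)))

-- The empty poset is excluded: every family contains a weak copy of it, so
-- there would be no free family to maximise over.
La-exists : ∀ n P → .{{ℕ.NonZero (FinitePoset.size P)}} → ∃ (IsMaximum (FreeSize n P))
La-exists n P = maximum (freeSize? P n) (∅-free P) (2 ℕ.^ n)
  λ { (𝓕 , _ , refl) → ∣𝓕∣≤2^n 𝓕 }

La : ∀ n P → .{{ℕ.NonZero (FinitePoset.size P)}} → ℕ
La n P = proj₁ (La-exists n P)

data Crown : Set where
  a₁ a₂ a₃ b₁₂ b₁₃ b₂₃ : Crown

data _≺_ : Crown → Crown → Set where
  a₁≺b₁₂ : a₁ ≺ b₁₂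
  a₁≺b₁₃ : a₁ ≺ b₁₃
  a₂≺b₁₂ : a₂ ≺ b₁₂
  a₂≺b₂₃ : a₂ ≺ b₂₃
  a₃≺b₁₃ : a₃ ≺ b₁₃
  a₃≺b₂₃ : a₃ ≺ b₂₃

private

  ≺-isStrictPartialOrder : IsStrictPartialOrder _≡_ _≺_
  ≺-isStrictPartialOrder = record
    { isEquivalence = isEquivalence
    ; irrefl        = λ { refl () }
    ; trans         = λ { a₁≺b₁₂ () ; a₁≺b₁₃ () ; a₂≺b₁₂ ()
                        ; a₂≺b₂₃ () ; a₃≺b₁₃ () ; a₃≺b₂₃ () }
    ; <-resp-≈      = resp₂ _≺_
    }

  _≺?_ : ∀ p q → Dec (p ≺ q)
  a₁  ≺? b₁₂ = yes a₁≺b₁₂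
  a₁  ≺? b₁₃ = yes a₁≺b₁₃
  a₂  ≺? b₁₂ = yes a₂≺b₁₂
  a₂  ≺? b₂₃ = yes a₂≺b₂₃
  a₃  ≺? b₁₃ = yes a₃≺b₁₃
  a₃  ≺? b₂₃ = yes a₃≺b₂₃
  a₁  ≺? a₁  = no λ ()
  a₁  ≺? a₂  = no λ ()
  a₁  ≺? a₃  = no λ ()
  a₁  ≺? b₂₃ = no λ ()
  a₂  ≺? a₁  = no λ ()
  a₂  ≺? a₂  = no λ ()
  a₂  ≺? a₃  = no λ ()
  a₂  ≺? b₁₃ = no λ ()
  a₃  ≺? a₁  = no λ ()
  a₃  ≺? a₂  = no λ ()
  a₃  ≺? a₃  = no λ ()
  a₃  ≺? b₁₂ = no λ ()
  b₁₂ ≺? _   = no λ ()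
  b₁₃ ≺? _   = no λ ()
  b₂₃ ≺? _   = no λ ()

  crown↔Fin6 : Crown ↔ Fin 6
  crown↔Fin6 = mk↔ₛ′
    (λ { a₁ → 0F ; a₂ → 1F ; a₃ → 2F ; b₁₂ → 3F ; b₁₃ → 4F ; b₂₃ → 5F })
    (λ { 0F → a₁ ; 1F → a₂ ; 2F → a₃ ; 3F → b₁₂ ; 4F → b₁₃ ; 5F → b₂₃ })
    (λ { 0F → refl ; 1F → refl ; 2F → refl ; 3F → refl ; 4F → refl ; 5F → refl })
    (λ { a₁ → refl ; a₂ → refl ; a₃ → refl ; b₁₂ → refl ; b₁₃ → refl ; b₂₃ → refl })

  _≟ᶜ_ : DecidableEquality Crown
  _≟ᶜ_ = Fin.inj⇒≟ (↔⇒↣ crown↔Fin6)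

O₆ : FinitePoset
O₆ = record
  { Carrier           = Crown
  ; _≼_               = StrictToNonStrict._≤_ _≡_ _≺_
  ; isDecPartialOrder = record
    { isPartialOrder = StrictToNonStrict.isPartialOrder _≡_ _≺_ ≺-isStrictPartialOrder
    ; _≟_            = _≟ᶜ_
    ; _≤?_           = StrictToNonStrict.decidable _≡_ _≺_ _≟ᶜ_ _≺?_
    }
  ; size              = 6
  ; enumeration       = crown↔Fin6
  }

IsCauchy : (ℕ → ℚ) → Set
IsCauchy x = ∀ ε → 0ℚ < ε →
  ∃[ N ] ∀ {m n} → N ℕ.≤ m → N ℕ.≤ n → ∣ x m - x n ∣ < ε

record ℝ : Set where
  field
    seq    : ℕ → ℚ
    cauchy : IsCauchy seq

open ℝ

private

  open +-*-Solver using (solve; _:+_; _:*_; :-_; _:-_; _:=_; con)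

  ½ε : ∀ ε → 0ℚ < ε → 0ℚ < ℚ.½ * ε
  ½ε ε ε>0 = subst (_< ℚ.½ * ε) (ℚ.*-zeroʳ ℚ.½) (ℚ.*-monoʳ-<-pos ℚ.½ ε>0)

  ½+½ : ∀ ε → ℚ.½ * ε + ℚ.½ * ε ≡ ε
  ½+½ = solve 1 (λ ε → con ℚ.½ :* ε :+ con ℚ.½ :* ε := ε) refl

  +-cauchy : ∀ {x y} → IsCauchy x → IsCauchy y → IsCauchy (λ n → x n + y n)
  +-cauchy {x} {y} cx cy ε ε>0 =
    let N₁ , h₁ = cx (ℚ.½ * ε) (½ε ε ε>0)
        N₂ , h₂ = cy (ℚ.½ * ε) (½ε ε ε>0)
    in N₁ ℕ.⊔ N₂ , λ {m} {n} ≤m ≤n → begin-strict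
      ∣ (x m + y m) - (x n + y n) ∣   ≡⟨ cong ∣_∣ (regroup (x m) (y m) (x n) (y n)) ⟩
      ∣ (x m - x n) + (y m - y n) ∣   ≤⟨ ℚ.∣p+q∣≤∣p∣+∣q∣ (x m - x n) (y m - y n) ⟩
      ∣ x m - x n ∣ + ∣ y m - y n ∣   <⟨ ℚ.+-mono-<
          (h₁ (ℕ.≤-trans (ℕ.m≤m⊔n N₁ N₂) ≤m) (ℕ.≤-trans (ℕ.m≤m⊔n N₁ N₂) ≤n))
          (h₂ (ℕ.≤-trans (ℕ.m≤n⊔m N₁ N₂) ≤m) (ℕ.≤-trans (ℕ.m≤n⊔m N₁ N₂) ≤n)) ⟩
      ℚ.½ * ε + ℚ.½ * ε               ≡⟨ ½+½ ε ⟩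
      ε                               ∎
    where
    open ℚ.≤-Reasoning
    regroup : ∀ a b c d → (a + b) - (c + d) ≡ (a - c) + (b - d)
    regroup = solve 4 (λ a b c d → (a :+ b) :- (c :+ d) := (a :- c) :+ (b :- d)) refl

  neg-cauchy : ∀ {x} → IsCauchy x → IsCauchy (λ n → - x n)
  neg-cauchy {x} cx ε ε>0 =
    let N , h = cx ε ε>0
    in N , λ {m} {n} ≤m ≤n → subst (_< ε)
      (sym (trans (cong ∣_∣ (flip (x m) (x n))) (ℚ.∣-p∣≡∣p∣ (x m - x n)))) (h ≤m ≤n)
    where
    flip : ∀ a b → - a - - b ≡ - (a - b)
    flip = solve 2 (λ a b → :- a :- :- b := :- (a :- b)) refl

  ∣a∣-∣b∣≤∣a-b∣ : ∀ a b → ∣ a ∣ - ∣ b ∣ ≤ ∣ a - b ∣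
  ∣a∣-∣b∣≤∣a-b∣ a b = subst (∣ a ∣ - ∣ b ∣ ≤_) (cancel ∣ a - b ∣ ∣ b ∣)
    (ℚ.+-monoˡ-≤ (- ∣ b ∣)
      (subst (λ z → ∣ z ∣ ≤ ∣ a - b ∣ + ∣ b ∣) (split a b) (ℚ.∣p+q∣≤∣p∣+∣q∣ (a - b) b)))
    where
    split : ∀ a b → (a - b) + b ≡ a
    split = solve 2 (λ a b → (a :- b) :+ b := a) refl
    cancel : ∀ a b → (a + b) - b ≡ a
    cancel = solve 2 (λ a b → (a :+ b) :- b := a) refl

  -[a-b] : ∀ a b → - (a - b) ≡ b - a
  -[a-b] = solve 2 (λ a b → :- (a :- b) := b :- a) refl

  ∣-∣-comm : ∀ a b → ∣ a - b ∣ ≡ ∣ b - a ∣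
  ∣-∣-comm a b = trans (sym (ℚ.∣-p∣≡∣p∣ (a - b))) (cong ∣_∣ (-[a-b] a b))

  ∣-∣-lipschitz : ∀ a b → ∣ ∣ a ∣ - ∣ b ∣ ∣ ≤ ∣ a - b ∣
  ∣-∣-lipschitz a b with ℚ.∣p∣≡p∨∣p∣≡-p (∣ a ∣ - ∣ b ∣)
  ... | inj₁ eq = subst (_≤ ∣ a - b ∣) (sym eq) (∣a∣-∣b∣≤∣a-b∣ a b)
  ... | inj₂ eq = subst₂ _≤_ (sym (trans eq (-[a-b] ∣ a ∣ ∣ b ∣))) (∣-∣-comm b a)
                    (∣a∣-∣b∣≤∣a-b∣ b a)

  ∣-∣-cauchy : ∀ {x} → IsCauchy x → IsCauchy (λ n → ∣ x n ∣)
  ∣-∣-cauchy {x} cx ε ε>0 =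
    let N , h = cx ε ε>0
    in N , λ {m} {n} ≤m ≤n → ℚ.≤-<-trans (∣-∣-lipschitz (x m) (x n)) (h ≤m ≤n)

  eventuallyBounded : ∀ {x} → IsCauchy x →
    ∃[ B ] 0ℚ < B × ∃[ N ] ∀ {n} → N ℕ.≤ n → ∣ x n ∣ ≤ B
  eventuallyBounded {x} cx =
    let N , h = cx 1ℚ (ℚ.positive⁻¹ 1ℚ)
    in ∣ x N ∣ + 1ℚ
     , ℚ.+-mono-≤-< {0ℚ} {∣ x N ∣} {0ℚ} {1ℚ} (ℚ.0≤∣p∣ (x N)) (ℚ.positive⁻¹ 1ℚ)
     , N , λ {n} ≤n → begin
      ∣ x n ∣                   ≡⟨ cong ∣_∣ (split (x n) (x N)) ⟩
      ∣ x N + (x n - x N) ∣     ≤⟨ ℚ.∣p+q∣≤∣p∣+∣q∣ (x N) (x n - x N) ⟩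
      ∣ x N ∣ + ∣ x n - x N ∣   ≤⟨ ℚ.+-monoʳ-≤ ∣ x N ∣ (ℚ.<⇒≤ (h ≤n ℕ.≤-refl)) ⟩
      ∣ x N ∣ + 1ℚ              ∎
    where
    open ℚ.≤-Reasoning
    split : ∀ a b → a ≡ b + (a - b)
    split = solve 2 (λ a b → a := b :+ (a :- b)) refl

  tolerance : ∀ B C ε → 0ℚ < B → 0ℚ < C → 0ℚ < ε → ∃[ δ ] 0ℚ < δ × B * δ + C * δ ≡ ε
  tolerance B C ε B>0 C>0 ε>0 = scale (B + C) (ℚ.+-mono-< B>0 C>0) refl
    where
    collect : ∀ B C k ε → B * (k * ε) + C * (k * ε) ≡ ((B + C) * k) * ε
    collect = solve 4 (λ B C k ε → B :* (k :* ε) :+ C :* (k :* ε) := ((B :+ C) :* k) :* ε) refl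
    scale : ∀ K → 0ℚ < K → B + C ≡ K → ∃[ δ ] 0ℚ < δ × B * δ + C * δ ≡ ε
    scale K K>0 eq = k * ε , δ>0 , (begin
      B * (k * ε) + C * (k * ε)   ≡⟨ collect B C k ε ⟩
      ((B + C) * k) * ε           ≡⟨ cong (λ z → (z * k) * ε) eq ⟩
      (K * k) * ε                 ≡⟨ cong (_* ε) (ℚ.*-inverseʳ K) ⟩
      1ℚ * ε                      ≡⟨ ℚ.*-identityˡ ε ⟩
      ε                           ∎)
      where
      open ≡-Reasoning
      instance
        K-pos : ℚ.Positive K
        K-pos = ℚ.positive K>0
        K-nonZero : ℚ.NonZero K
        K-nonZero = ℚ.pos⇒nonZero K
      k = ℚ.1/ K
      δ>0 : 0ℚ < k * ε
      δ>0 = subst (_< k * ε) (ℚ.*-zeroʳ k) (ℚ.*-monoʳ-<-pos k {{ℚ.1/pos⇒pos K}} ε>0)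

  *-difference : ∀ a b a′ b′ B C δ → 0ℚ < B → 0ℚ < C → ∣ a ∣ ≤ B → ∣ b′ ∣ ≤ C →
                 ∣ a - a′ ∣ < δ → ∣ b - b′ ∣ < δ → ∣ a * b - a′ * b′ ∣ < B * δ + C * δ
  *-difference a b a′ b′ B C δ B>0 C>0 a≤B b′≤C da db = begin-strict
    ∣ a * b - a′ * b′ ∣                      ≡⟨ cong ∣_∣ (regroup a b a′ b′) ⟩
    ∣ a * (b - b′) + b′ * (a - a′) ∣         ≤⟨ ℚ.∣p+q∣≤∣p∣+∣q∣ (a * (b - b′)) (b′ * (a - a′)) ⟩
    ∣ a * (b - b′) ∣ + ∣ b′ * (a - a′) ∣     ≡⟨ cong₂ _+_ (ℚ.∣p*q∣≡∣p∣*∣q∣ a (b - b′)) (ℚ.∣p*q∣≡∣p∣*∣q∣ b′ (a - a′)) ⟩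
    ∣ a ∣ * ∣ b - b′ ∣ + ∣ b′ ∣ * ∣ a - a′ ∣ ≤⟨ ℚ.+-mono-≤
      (ℚ.*-monoʳ-≤-nonNeg ∣ b - b′ ∣ {{ℚ.∣-∣-nonNeg (b - b′)}} a≤B)
      (ℚ.*-monoʳ-≤-nonNeg ∣ a - a′ ∣ {{ℚ.∣-∣-nonNeg (a - a′)}} b′≤C) ⟩
    B * ∣ b - b′ ∣ + C * ∣ a - a′ ∣          <⟨ ℚ.+-mono-<
      (ℚ.*-monoʳ-<-pos B {{ℚ.positive B>0}} db)
      (ℚ.*-monoʳ-<-pos C {{ℚ.positive C>0}} da) ⟩
    B * δ + C * δ                            ∎
    where
    open ℚ.≤-Reasoning
    regroup : ∀ a b c d → a * b - c * d ≡ a * (b - d) + d * (a - c)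
    regroup = solve 4 (λ a b c d → a :* b :- c :* d := a :* (b :- d) :+ d :* (a :- c)) refl

  *-cauchy : ∀ {x y} → IsCauchy x → IsCauchy y → IsCauchy (λ n → x n * y n)
  *-cauchy {x} {y} cx cy ε ε>0 =
    let B , B>0 , M₁ , bx = eventuallyBounded {x} cx
        C , C>0 , M₂ , by = eventuallyBounded {y} cy
        δ , δ>0 , eq      = tolerance B C ε B>0 C>0 ε>0
        N₁ , hx           = cx δ δ>0
        N₂ , hy           = cy δ δ>0
        M = M₁ ℕ.⊔ M₂
        N = N₁ ℕ.⊔ N₂
        to₁ : ∀ {k} → M ℕ.⊔ N ℕ.≤ k → N₁ ℕ.≤ k
        to₁ ≤k = ℕ.≤-trans (ℕ.m≤m⊔n N₁ N₂) (ℕ.≤-trans (ℕ.m≤n⊔m M N) ≤k)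
        to₂ : ∀ {k} → M ℕ.⊔ N ℕ.≤ k → N₂ ℕ.≤ k
        to₂ ≤k = ℕ.≤-trans (ℕ.m≤n⊔m N₁ N₂) (ℕ.≤-trans (ℕ.m≤n⊔m M N) ≤k)
    in M ℕ.⊔ N , λ {m} {n} ≤m ≤n → subst (∣ x m * y m - x n * y n ∣ <_) eq
      (*-difference (x m) (y m) (x n) (y n) B C δ B>0 C>0
        (bx (ℕ.≤-trans (ℕ.m≤m⊔n M₁ M₂) (ℕ.≤-trans (ℕ.m≤m⊔n M N) ≤m)))
        (by (ℕ.≤-trans (ℕ.m≤n⊔m M₁ M₂) (ℕ.≤-trans (ℕ.m≤m⊔n M N) ≤n)))
        (hx (to₁ ≤m) (to₁ ≤n))
        (hy (to₂ ≤m) (to₂ ≤n)))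

fromℚ : ℚ → ℝ
fromℚ q .seq    _       = q
fromℚ q .cauchy ε ε>0   = 0 , λ _ _ → subst (_< ε) (sym (cong ∣_∣ (ℚ.+-inverseʳ q))) ε>0

fromℕ : ℕ → ℝ
fromℕ k = fromℚ (+ k / 1)

infixl 6 _+ᴿ_ _-ᴿ_
infixl 7 _*ᴿ_
infix  8 -ᴿ_
infix  4 _<ᴿ_ _≤ᴿ_ _>ᴿ_ _≥ᴿ_ _⟶_

_+ᴿ_ _*ᴿ_ : ℝ → ℝ → ℝ
(x +ᴿ y) .seq n  = x .seq n + y .seq n
(x +ᴿ y) .cauchy = +-cauchy {x .seq} {y .seq} (x .cauchy) (y .cauchy)
(x *ᴿ y) .seq n  = x .seq n * y .seq n
(x *ᴿ y) .cauchy = *-cauchy {x .seq} {y .seq} (x .cauchy) (y .cauchy)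

-ᴿ_ ∣_∣ᴿ : ℝ → ℝ
(-ᴿ x) .seq n  = - x .seq n
(-ᴿ x) .cauchy = neg-cauchy {x .seq} (x .cauchy)
∣ x ∣ᴿ .seq n  = ∣ x .seq n ∣
∣ x ∣ᴿ .cauchy = ∣-∣-cauchy {x .seq} (x .cauchy)

_-ᴿ_ : ℝ → ℝ → ℝ
x -ᴿ y = x +ᴿ (-ᴿ y)

_<ᴿ_ _≤ᴿ_ _>ᴿ_ _≥ᴿ_ : ℝ → ℝ → Set
x <ᴿ y = ∃[ ε ] 0ℚ < ε × ∃[ N ] ∀ n → N ℕ.≤ n → x .seq n + ε ≤ y .seq n
x ≤ᴿ y = ∀ ε → 0ℚ < ε → ∃[ N ] ∀ n → N ℕ.≤ n → x .seq n ≤ y .seq n + ε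
x >ᴿ y = y <ᴿ x
x ≥ᴿ y = y ≤ᴿ x

_⟶_ : (ℕ → ℝ) → ℝ → Set
x ⟶ L = ∀ ε → 0ℚ < ε → ∃[ N ] ∀ n → N ℕ.≤ n → ∣ x n -ᴿ L ∣ᴿ <ᴿ fromℚ ε

-- A real is the limit of its defining sequence, so an infinite sum or product
-- of rationals is given below by the sequence of its partial sums or products.
seq-⟶ : ∀ x → (λ n → fromℚ (x .seq n)) ⟶ x
seq-⟶ x ε ε>0 =
  let N , h = x .cauchy (ℚ.½ * ε) (½ε ε ε>0)
  in N , λ m ≤m → ℚ.½ * ε , ½ε ε ε>0 , N , λ n ≤n →
    subst (∣ x .seq m - x .seq n ∣ + ℚ.½ * ε ≤_) (½+½ ε)
      (ℚ.+-monoˡ-≤ (ℚ.½ * ε) (ℚ.<⇒≤ (h ≤m ≤n)))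

fold₁ : {A : Set} → (A → A → A) → A → ℕ → (ℕ → A) → A
fold₁ _∙_ e zero    f = e
fold₁ _∙_ e (suc m) f = fold₁ _∙_ e m f ∙ f (suc m)

Σ₁ Π₁ : ℕ → (ℕ → ℚ) → ℚ
Σ₁ = fold₁ _+_ 0ℚ
Π₁ = fold₁ _*_ 1ℚ

Πᴺ₁ : ℕ → (ℕ → ℕ) → ℕ
Πᴺ₁ = fold₁ ℕ._*_ 1

infix 9 2^-_

2^-_ : ℕ → ℚ
2^- i = (+ 1 / (2 ℕ.^ i)) {{ℕ.m^n≢0 2 i}}

D : ℕ → ℕ
D m = Πᴺ₁ m (λ i → 2 ℕ.^ i ℕ.∸ 1)

D-nonZero : ∀ m → ℕ.NonZero (D m)
D-nonZero zero    = _
D-nonZero (suc m) = ℕ.m*n≢0 (D m) (2 ℕ.^ suc m ℕ.∸ 1) {{D-nonZero m}}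
  {{ℕ.>-nonZero (ℕ.m<n⇒0<n∸m {1} (ℕ.^-monoʳ-< 2 (ℕ.s≤s (ℕ.s≤s ℕ.z≤n)) {0} {suc m} ℕ.z<s))}}

D²-nonZero : ∀ m → ℕ.NonZero (D m ℕ.^ 2)
D²-nonZero m = ℕ.m^n≢0 (D m) 2 {{D-nonZero m}}

summand : ℕ → ℚ
summand j = 2^- j * (+ 1 / (D (pred j) ℕ.^ 2)) {{D²-nonZero (pred j)}}

private

  toℚᵘ-1/ : ∀ k .{{_ : ℕ.NonZero k}} → ℚ.toℚᵘ (+ 1 / k) ℚᵘ.≃ (+ 1 ℚᵘ./ k)
  toℚᵘ-1/ (suc k) = ℚ.toℚᵘ-fromℚᵘ (+ 1 ℚᵘ./ suc k)

  1/-antitone : ∀ k l .{{_ : ℕ.NonZero k}} .{{_ : ℕ.NonZero l}} → k ℕ.≤ l → + 1 / l ≤ + 1 / k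
  1/-antitone k@(suc _) l@(suc _) k≤l = ℚ.toℚᵘ-cancel-≤
    (ℚᵘ.≤-respˡ-≃ (ℚᵘ.≃-sym (toℚᵘ-1/ l))
    (ℚᵘ.≤-respʳ-≃ (ℚᵘ.≃-sym (toℚᵘ-1/ k))
      (ℚᵘ.*≤* (subst₂ ℤ._≤_ (sym (ℤ.*-identityˡ (+ k))) (sym (ℤ.*-identityˡ (+ l))) (ℤ.+≤+ k≤l)))))

  2^-≥0 : ∀ i → 0ℚ ≤ 2^- i
  2^-≥0 i = ℚ.<⇒≤ (ℚ.positive⁻¹ (2^- i) {{ℚ.normalize-pos 1 (2 ℕ.^ i) {{ℕ.m^n≢0 2 i}}}})

  toℚᵘ-2^- : ∀ i → ℚ.toℚᵘ (2^- i) ℚᵘ.≃ (+ 1 ℚᵘ./ (2 ℕ.^ i)) {{ℕ.m^n≢0 2 i}}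
  toℚᵘ-2^- i = toℚᵘ-1/ (2 ℕ.^ i) {{ℕ.m^n≢0 2 i}}

  ½*1/k : ∀ k .{{_ : ℕ.NonZero k}} .{{_ : ℕ.NonZero (2 ℕ.* k)}} →
          (+ 1 ℚᵘ./ (2 ℕ.* k)) ℚᵘ.≃ ℚᵘ.½ ℚᵘ.* (+ 1 ℚᵘ./ k)
  ½*1/k (suc k) = ℚᵘ.*≡* refl

  2^-suc : ∀ i → 2^- suc i ≡ ℚ.½ * 2^- i
  2^-suc i = ℚ.toℚᵘ-injective (begin
    ℚ.toℚᵘ (2^- suc i)                   ≈⟨ toℚᵘ-2^- (suc i) ⟩
    (+ 1 ℚᵘ./ (2 ℕ.^ suc i)) {{nz′}}     ≈⟨ ½*1/k (2 ℕ.^ i) {{nz}} {{nz′}} ⟩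
    ℚᵘ.½ ℚᵘ.* (+ 1 ℚᵘ./ (2 ℕ.^ i)) {{nz}} ≈⟨ ℚᵘ.*-congˡ {ℚᵘ.½} (ℚᵘ.≃-sym (toℚᵘ-2^- i)) ⟩
    ℚᵘ.½ ℚᵘ.* ℚ.toℚᵘ (2^- i)             ≈⟨ ℚᵘ.≃-sym (ℚ.toℚᵘ-homo-* ℚ.½ (2^- i)) ⟩
    ℚ.toℚᵘ (ℚ.½ * 2^- i)                 ∎)
    where
    open ℚᵘ.≃-Reasoning
    nz  = ℕ.m^n≢0 2 i
    nz′ = ℕ.m^n≢0 2 (suc i)

  n<2^n : ∀ n → n ℕ.< 2 ℕ.^ n
  n<2^n zero    = ℕ.z<s
  n<2^n (suc n) = begin-strict
    suc n                       <⟨ ℕ.s<s (n<2^n n) ⟩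
    1 ℕ.+ 2 ℕ.^ n               ≤⟨ ℕ.+-monoˡ-≤ (2 ℕ.^ n) (ℕ.m^n>0 2 n) ⟩
    2 ℕ.^ n ℕ.+ 2 ℕ.^ n         ≡⟨ cong (2 ℕ.^ n ℕ.+_) (sym (ℕ.+-identityʳ (2 ℕ.^ n))) ⟩
    2 ℕ.^ suc n                 ∎
    where open ℕ.≤-Reasoning

  2^-small : ∀ ε → 0ℚ < ε → ∃[ N ] 2^- N < ε
  2^-small ε@(ℚ.mkℚ (+ zero) _ _) ε>0 = ⊥-elim (ℚ.<-irrefl (sym (ℚ.↥p≡0⇒p≡0 ε refl)) ε>0)
  2^-small (ℚ.mkℚ (ℤ.-[1+ _ ]) _ _) (ℚ.*<* ())
  2^-small ε@(ℚ.mkℚ (+ suc p) d _) _ =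
    q , ℚ.toℚᵘ-cancel-< (ℚᵘ.<-respˡ-≃ (ℚᵘ.≃-sym (toℚᵘ-2^- q)) (below (2 ℕ.^ q) {{ℕ.m^n≢0 2 q}} q<))
    where
    q = suc d
    q< : 1 ℕ.* q ℕ.< suc p ℕ.* 2 ℕ.^ q
    q< = subst (ℕ._< suc p ℕ.* 2 ℕ.^ q) (sym (ℕ.*-identityˡ q))
           (ℕ.<-≤-trans (n<2^n q) (ℕ.m≤m+n (2 ℕ.^ q) (p ℕ.* 2 ℕ.^ q)))
    below : ∀ k .{{_ : ℕ.NonZero k}} → 1 ℕ.* q ℕ.< suc p ℕ.* k → (+ 1 ℚᵘ./ k) ℚᵘ.< ℚ.toℚᵘ ε
    below (suc k) lt = ℚᵘ.*<* (ℤ.+<+ lt)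

  geometric⇒cauchy : ∀ x → (∀ n → ∣ x (suc n) - x n ∣ ≤ 2^- suc n) → IsCauchy x
  geometric⇒cauchy x step ε ε>0 =
    let N , small = 2^-small (ℚ.½ * ε) (½ε ε ε>0)
    in N , λ {m} {n} ≤m ≤n → begin-strict
      ∣ x m - x n ∣                       ≡⟨ cong ∣_∣ (split (x m) (x n) (x N)) ⟩
      ∣ (x m - x N) - (x n - x N) ∣       ≤⟨ ℚ.∣p-q∣≤∣p∣+∣q∣ (x m - x N) (x n - x N) ⟩
      ∣ x m - x N ∣ + ∣ x n - x N ∣       <⟨ ℚ.+-mono-< (ℚ.≤-<-trans (tail ≤m) small) (ℚ.≤-<-trans (tail ≤n) small) ⟩
      ℚ.½ * ε + ℚ.½ * ε                   ≡⟨ ½+½ ε ⟩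
      ε                                   ∎
    where
    open ℚ.≤-Reasoning
    split : ∀ a b c → a - b ≡ (a - c) - (b - c)
    split = solve 3 (λ a b c → a :- b := (a :- c) :- (b :- c)) refl
    telescope : ∀ a b c → a - c ≡ (a - b) + (b - c)
    telescope = solve 3 (λ a b c → a :- c := (a :- b) :+ (b :- c)) refl
    collect : ∀ a b → ℚ.½ * a + (b - a) ≡ b - ℚ.½ * a
    collect = solve 2 (λ a b → con ℚ.½ :* a :+ (b :- a) := b :- con ℚ.½ :* a) refl
    dist : ∀ d n → ∣ x (d ℕ.+ n) - x n ∣ ≤ 2^- n - 2^- (d ℕ.+ n)
    dist zero n = ℚ.≤-reflexive (trans (cong ∣_∣ (ℚ.+-inverseʳ (x n))) (sym (ℚ.+-inverseʳ (2^- n))))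
    dist (suc d) n = let k = d ℕ.+ n in begin
      ∣ x (suc k) - x n ∣                     ≡⟨ cong ∣_∣ (telescope (x (suc k)) (x k) (x n)) ⟩
      ∣ (x (suc k) - x k) + (x k - x n) ∣     ≤⟨ ℚ.∣p+q∣≤∣p∣+∣q∣ (x (suc k) - x k) (x k - x n) ⟩
      ∣ x (suc k) - x k ∣ + ∣ x k - x n ∣     ≤⟨ ℚ.+-mono-≤ (step k) (dist d n) ⟩
      2^- suc k + (2^- n - 2^- k)             ≡⟨ cong (_+ (2^- n - 2^- k)) (2^-suc k) ⟩
      ℚ.½ * 2^- k + (2^- n - 2^- k)           ≡⟨ collect (2^- k) (2^- n) ⟩
      2^- n - ℚ.½ * 2^- k                     ≡⟨ cong (λ z → 2^- n - z) (sym (2^-suc k)) ⟩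
      2^- n - 2^- suc k                       ∎
    tail : ∀ {N n} → N ℕ.≤ n → ∣ x n - x N ∣ ≤ 2^- N
    tail {N} {n} N≤n = begin
      ∣ x n - x N ∣                        ≡⟨ cong (λ z → ∣ x z - x N ∣) (sym (ℕ.m∸n+n≡m N≤n)) ⟩
      ∣ x (n ℕ.∸ N ℕ.+ N) - x N ∣          ≤⟨ dist (n ℕ.∸ N) N ⟩
      2^- N - 2^- (n ℕ.∸ N ℕ.+ N)          ≤⟨ ℚ.+-monoʳ-≤ (2^- N) (ℚ.neg-antimono-≤ (2^-≥0 (n ℕ.∸ N ℕ.+ N))) ⟩
      2^- N + 0ℚ                           ≡⟨ ℚ.+-identityʳ (2^- N) ⟩
      2^- N                                ∎

  2^-≤1 : ∀ i → 2^- i ≤ 1ℚ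
  2^-≤1 i = 1/-antitone 1 (2 ℕ.^ i) {{_}} {{ℕ.m^n≢0 2 i}} (ℕ.m^n>0 2 i)

  *-≤ˡ : ∀ p q → 0ℚ ≤ p → q ≤ 1ℚ → p * q ≤ p
  *-≤ˡ p q p≥0 q≤1 = subst (p * q ≤_) (ℚ.*-identityʳ p)
    (ℚ.*-monoˡ-≤-nonNeg p {{ℚ.nonNegative p≥0}} q≤1)

  *-≥0 : ∀ p q → 0ℚ ≤ p → 0ℚ ≤ q → 0ℚ ≤ p * q
  *-≥0 p q p≥0 q≥0 = subst (_≤ p * q) (ℚ.*-zeroʳ p)
    (ℚ.*-monoˡ-≤-nonNeg p {{ℚ.nonNegative p≥0}} q≥0)

  factor : ℕ → ℚ
  factor i = 1ℚ - 2^- i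

  factor≥0 : ∀ i → 0ℚ ≤ factor i
  factor≥0 i = subst (_≤ factor i) (ℚ.+-inverseʳ 1ℚ) (ℚ.+-monoʳ-≤ 1ℚ (ℚ.neg-antimono-≤ (2^-≤1 i)))

  factor≤1 : ∀ i → factor i ≤ 1ℚ
  factor≤1 i = subst (factor i ≤_) (ℚ.+-identityʳ 1ℚ) (ℚ.+-monoʳ-≤ 1ℚ (ℚ.neg-antimono-≤ (2^-≥0 i)))

  Π-factor-bounds : ∀ m → 0ℚ ≤ Π₁ m factor × Π₁ m factor ≤ 1ℚ
  Π-factor-bounds zero    = ℚ.nonNegative⁻¹ 1ℚ , ℚ.≤-refl
  Π-factor-bounds (suc m) =
    let ≥0 , ≤1 = Π-factor-bounds m
    in *-≥0 (Π₁ m factor) (factor (suc m)) ≥0 (factor≥0 (suc m))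
     , ℚ.≤-trans (*-≤ˡ (Π₁ m factor) (factor (suc m)) ≥0 (factor≤1 (suc m))) ≤1

  Π-factor-step : ∀ n → ∣ Π₁ (suc n) factor - Π₁ n factor ∣ ≤ 2^- suc n
  Π-factor-step n = begin
    ∣ p * (1ℚ - t) - p ∣   ≡⟨ cong ∣_∣ (simplify p t) ⟩
    ∣ - (t * p) ∣          ≡⟨ ℚ.∣-p∣≡∣p∣ (t * p) ⟩
    ∣ t * p ∣              ≡⟨ ℚ.0≤p⇒∣p∣≡p (*-≥0 t p (2^-≥0 (suc n)) (proj₁ (Π-factor-bounds n))) ⟩
    t * p                  ≤⟨ *-≤ˡ t p (2^-≥0 (suc n)) (proj₂ (Π-factor-bounds n)) ⟩
    t                      ∎
    where
    open ℚ.≤-Reasoning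
    p = Π₁ n factor
    t = 2^- suc n
    simplify : ∀ p t → p * (1ℚ - t) - p ≡ - (t * p)
    simplify = solve 2 (λ p t → p :* (con 1ℚ :- t) :- p := :- (t :* p)) refl

  Σ-summand-step : ∀ n → ∣ Σ₁ (suc n) summand - Σ₁ n summand ∣ ≤ 2^- suc n
  Σ-summand-step n = begin
    ∣ (s + t * r) - s ∣   ≡⟨ cong ∣_∣ (simplify s (t * r)) ⟩
    ∣ t * r ∣             ≡⟨ ℚ.0≤p⇒∣p∣≡p (*-≥0 t r (2^-≥0 (suc n)) r≥0) ⟩
    t * r                 ≤⟨ *-≤ˡ t r (2^-≥0 (suc n)) r≤1 ⟩
    t                     ∎
    where
    open ℚ.≤-Reasoning
    instance D²≢0 = D²-nonZero n
    s = Σ₁ n summand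
    t = 2^- suc n
    r = + 1 / (D n ℕ.^ 2)
    r≥0 : 0ℚ ≤ r
    r≥0 = ℚ.<⇒≤ (ℚ.positive⁻¹ r {{ℚ.normalize-pos 1 (D n ℕ.^ 2)}})
    r≤1 : r ≤ 1ℚ
    r≤1 = 1/-antitone 1 (D n ℕ.^ 2) (ℕ.>-nonZero⁻¹ (D n ℕ.^ 2))
    simplify : ∀ a b → (a + b) - a ≡ b
    simplify = solve 2 (λ a b → (a :+ b) :- a := b) refl

Δ₂ : ℝ
Δ₂ .seq m  = Π₁ m (λ i → 1ℚ - 2^- i)
Δ₂ .cauchy = geometric⇒cauchy (λ m → Π₁ m factor) Π-factor-step

series : ℝ
series .seq m  = Σ₁ m summand
series .cauchy = geometric⇒cauchy (λ m → Σ₁ m summand) Σ-summand-step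

c : ℝ
c = Δ₂ *ᴿ series

{-# OPTIONS --safe #-}
module Submission where

-- Choose vectors v₁,…,vₙ and w in 𝔽₂ᵏ⁺¹, where k = ⌊n/2⌋.  Take the k-sets whose
-- vectors do not span w and the (k+1)-sets whose vectors do.  In a crown, each
-- upper set Bᵢⱼ yields a sum of vectors equal to w which uses both elements of
-- Bᵢⱼ outside A₁ ∩ A₂ ∩ A₃; adding the three sums gives 3w = w as a sum over
-- A₁ ∩ A₂ ∩ A₃, so A₁ would span w.  Averaged over uniformly random vectors, the
-- family has about (1 + g) (n choose k) members, where g is the probability that
-- one more vector brings w into the span of k vectors.  The distribution of the
-- codimension j of that span has a closed form, which gives g → c.

open import Defs
open import Data.Bool.Base using (Bool; true; false; not; _xor_; _∧_; _∨_; if_then_else_; T)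
import Data.Bool.Properties as Bool
open import Data.Empty using (⊥)
open import Data.Fin.Base using (Fin)
import Data.Fin.Properties as Fin
open import Data.Fin.Subset using (Subset; _∈_; _∉_; _⊆_; ∣_∣; ⊤)
  renaming (_-_ to _∖_)
import Data.Fin.Subset.Properties as Subset
open import Data.Integer.Base as ℤ using (+_)
import Data.Integer.Properties as ℤ
open import Data.List.Base as List using (List; []; _∷_; _++_; length; filterᵇ)
import Data.List.Properties as List
import Data.List.Membership.Propositional as List using (_∈_)
import Data.List.Membership.Propositional.Properties as List
open import Data.List.Membership.Propositional.Properties.WithK using (unique⇒irrelevant)
open import Data.List.Relation.Unary.All as All using (All; []; _∷_)
import Data.List.Relation.Unary.All.Properties as All
open import Data.List.Relation.Unary.AllPairs using ([]; _∷_)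
open import Data.List.Relation.Unary.Unique.Propositional using (Unique)
import Data.List.Relation.Unary.Unique.Propositional.Properties as Unique
open import Data.Nat.Base as ℕ using (ℕ; zero; suc; s≤s; z≤n; ⌊_/2⌋)
open import Data.Nat.Combinatorics using (_C_; nCk+nC[k+1]≡[n+1]C[k+1]; nC1≡n)
import Data.Nat.Properties as ℕ
open import Data.Nat.Solver using () renaming (module +-*-Solver to ℕSolver)
open import Data.Product.Base using (∃-syntax; Σ-syntax; _×_; _,_; proj₁; proj₂)
open import Data.Product.Properties using (Σ-≡,≡→≡)
open import Data.Rational.Base as ℚ using (ℚ; 0ℚ; 1ℚ; ½; _/_; _+_; _*_; _-_; _≤_; _<_)
import Data.Rational.Properties as ℚ
open import Data.Rational.Solver using (module +-*-Solver)
import Data.Rational.Unnormalised.Base as ℚᵘ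
import Data.Rational.Unnormalised.Properties as ℚᵘ
open import Data.Sum.Base using (inj₁; inj₂)
open import Data.Vec.Base as Vec using (Vec; []; _∷_; lookup; replicate; zipWith)
import Data.Vec.Properties as Vec
open import Function.Base using (_∘_; case_of_; id; const)
open import Function.Bundles using (module Bijection)
open import Relation.Binary.PropositionalEquality
open import Relation.Nullary using (yes; no; ¬_; contradiction)
open import Relation.Nullary.Decidable using (T?; does; dec-true; dec-false; toWitness)

open +-*-Solver using (solve; _:+_; _:*_; _:-_; _:=_; con)
open ℕSolver using () renaming (_:+_ to _+′_; _:*_ to _*′_; _:=_ to _=′_; con to con′)

-- Because `w` is random as well, a span enters the averages only through its density 2^-j, where j
-- is its codimension: this is the chance that it contains `w`, and a new vector either keeps it or
-- doubles it. All averages thus reduce to a Markov chain on one rational, and g is the mean of x(1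
-- - x) after k steps started at x = 2^-(k+1). In dimension k+1, codimension j means that j - 1 of
-- the k vectors are redundant. With `Q m` the m-th partial product of `Δ₂`, the probability of this
-- tends to Δ₂ 2^-(j(j-1)) / (Q(j-1) Q(j)) as k grows. At x = 2^-j the factor 1 - x cancels the last
-- factor of Q(j), leaving Q(j-1) squared, and clearing powers of 2 from that square removes
-- 2^-(j(j-1)). What remains is Δ₂ 2^-j / D(j-1)², the j-th term of c. A lower bound on g suffices,
-- so the sum over j can be cut after k terms, where each term is compared with its limiting shape
-- at a loss of at most 2^-(k+1). The comparison is with the k-th approximation of c, so that c
-- itself enters only at the very end.

private variable
  X : Set
  n d : ℕ
  A A′ B B′ : Subset n

-- Vectors over 𝔽₂

infixl 6 _⊕_

_⊕_ : Vec Bool d → Vec Bool d → Vec Bool d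
_⊕_ = zipWith _xor_

𝟘 : Vec Bool d
𝟘 = replicate _ false

⊕-assoc : ∀ (x y z : Vec Bool d) → (x ⊕ y) ⊕ z ≡ x ⊕ (y ⊕ z)
⊕-assoc = Vec.zipWith-assoc Bool.xor-assoc

⊕-comm : ∀ (x y : Vec Bool d) → x ⊕ y ≡ y ⊕ x
⊕-comm = Vec.zipWith-comm Bool.xor-comm

⊕-identityˡ : ∀ (x : Vec Bool d) → 𝟘 ⊕ x ≡ x
⊕-identityˡ = Vec.zipWith-identityˡ Bool.xor-identityˡ

⊕-identityʳ : ∀ (x : Vec Bool d) → x ⊕ 𝟘 ≡ x
⊕-identityʳ = Vec.zipWith-identityʳ Bool.xor-identityʳ

⊕-self : ∀ (x : Vec Bool d) → x ⊕ x ≡ 𝟘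
⊕-self []      = refl
⊕-self (b ∷ x) = cong₂ _∷_ (Bool.xor-same b) (⊕-self x)

⊕-cancelˡ : ∀ (x y : Vec Bool d) → x ⊕ (x ⊕ y) ≡ y
⊕-cancelˡ x y = begin
  x ⊕ (x ⊕ y)   ≡⟨ ⊕-assoc x x y ⟨
  (x ⊕ x) ⊕ y   ≡⟨ cong (_⊕ y) (⊕-self x) ⟩
  𝟘 ⊕ y         ≡⟨ ⊕-identityˡ y ⟩
  y             ∎
  where open ≡-Reasoning

⊕-interchange : ∀ (x y z t : Vec Bool d) → (x ⊕ y) ⊕ (z ⊕ t) ≡ (x ⊕ z) ⊕ (y ⊕ t)
⊕-interchange x y z t = begin
  (x ⊕ y) ⊕ (z ⊕ t)   ≡⟨ ⊕-assoc x y (z ⊕ t) ⟩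
  x ⊕ (y ⊕ (z ⊕ t))   ≡⟨ cong (x ⊕_) (sym (⊕-assoc y z t)) ⟩
  x ⊕ ((y ⊕ z) ⊕ t)   ≡⟨ cong (λ u → x ⊕ (u ⊕ t)) (⊕-comm y z) ⟩
  x ⊕ ((z ⊕ y) ⊕ t)   ≡⟨ cong (x ⊕_) (⊕-assoc z y t) ⟩
  x ⊕ (z ⊕ (y ⊕ t))   ≡⟨ ⊕-assoc x z (y ⊕ t) ⟨
  (x ⊕ z) ⊕ (y ⊕ t)   ∎
  where open ≡-Reasoning

scale : Bool → Vec Bool d → Vec Bool d
scale b v = if b then v else 𝟘

scale-xor : ∀ a b (v : Vec Bool d) → scale (a xor b) v ≡ scale a v ⊕ scale b v
scale-xor false b     v = sym (⊕-identityˡ (scale b v))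
scale-xor true  false v = sym (⊕-identityʳ v)
scale-xor true  true  v = sym (⊕-self v)

total : Subset n → Vec (Vec Bool d) n → Vec Bool d
total []      []      = 𝟘
total (b ∷ α) (v ∷ V) = scale b v ⊕ total α V

-- `Subset n` is `Vec Bool n`, so on selections `⊕` is the symmetric difference: elements chosen by
-- both cancel, as their vectors do in characteristic 2.
total-⊕ : ∀ (α β : Subset n) (V : Vec (Vec Bool d) n) → total (α ⊕ β) V ≡ total α V ⊕ total β V
total-⊕ []      []      []      = sym (⊕-identityˡ 𝟘)
total-⊕ (a ∷ α) (b ∷ β) (v ∷ V) = begin
  scale (a xor b) v ⊕ total (α ⊕ β) V                   ≡⟨ cong₂ _⊕_ (scale-xor a b v) (total-⊕ α β V) ⟩
  (scale a v ⊕ scale b v) ⊕ (total α V ⊕ total β V)     ≡⟨ ⊕-interchange (scale a v) (scale b v) (total α V) (total β V) ⟩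
  (scale a v ⊕ total α V) ⊕ (scale b v ⊕ total β V)     ∎
  where open ≡-Reasoning

isZero : Vec Bool d → Bool
isZero []      = true
isZero (b ∷ w) = not b ∧ isZero w

isZero⇒≡𝟘 : ∀ (w : Vec Bool d) → isZero w ≡ true → w ≡ 𝟘
isZero⇒≡𝟘 []          _  = refl
isZero⇒≡𝟘 (false ∷ w) eq = cong (false ∷_) (isZero⇒≡𝟘 w eq)

isZero-𝟘 : ∀ d → isZero (𝟘 {d}) ≡ true
isZero-𝟘 zero    = refl
isZero-𝟘 (suc d) = isZero-𝟘 d

-- Boolean-valued, so that the same test filters the levels of the cube and serves as an indicator
-- to be averaged.
spans : Subset n → Vec (Vec Bool d) n → Vec Bool d → Bool
spans []          []      w = isZero w
spans (false ∷ S) (v ∷ V) w = spans S V w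
spans (true  ∷ S) (v ∷ V) w = spans S V w ∨ spans S V (v ⊕ w)

spans-sound : ∀ (S : Subset n) (V : Vec (Vec Bool d) n) w → spans S V w ≡ true →
              ∃[ α ] α ⊆ S × total α V ≡ w
spans-sound [] [] w eq = [] , (λ x∈ → x∈) , sym (isZero⇒≡𝟘 w eq)
spans-sound (false ∷ S) (v ∷ V) w eq =
  let α , α⊆S , tot = spans-sound S V w eq
  in false ∷ α , Subset.s⊆s α⊆S , trans (⊕-identityˡ (total α V)) tot
spans-sound (true ∷ S) (v ∷ V) w eq with spans S V w in eq₁
... | true =
  let α , α⊆S , tot = spans-sound S V w eq₁
  in false ∷ α , Subset.out⊆ α⊆S , trans (⊕-identityˡ (total α V)) tot
... | false =
  let α , α⊆S , tot = spans-sound S V (v ⊕ w) eq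
  in true ∷ α , Subset.s⊆s α⊆S , trans (cong (v ⊕_) tot) (⊕-cancelˡ v w)

spans-complete : ∀ (S : Subset n) (V : Vec (Vec Bool d) n) {α} → α ⊆ S →
                 spans S V (total α V) ≡ true
spans-complete {d = d} [] [] {[]} _ = isZero-𝟘 d
spans-complete (false ∷ S) (v ∷ V) {true ∷ α} α⊆S = case α⊆S Vec.here of λ ()
spans-complete (false ∷ S) (v ∷ V) {false ∷ α} α⊆S =
  trans (cong (spans S V) (⊕-identityˡ (total α V))) (spans-complete S V (Subset.drop-∷-⊆ α⊆S))
spans-complete (true ∷ S) (v ∷ V) {false ∷ α} α⊆S
  rewrite ⊕-identityˡ (total α V) | spans-complete S V (Subset.drop-∷-⊆ α⊆S) = refl
spans-complete (true ∷ S) (v ∷ V) {true ∷ α} α⊆S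
  rewrite ⊕-cancelˡ v (total α V) | spans-complete S V (Subset.drop-∷-⊆ α⊆S) =
  Bool.∨-zeroʳ _

∉⇒lookup : ∀ {x : Fin n} {S} → x ∉ S → lookup S x ≡ false
∉⇒lookup {x = x} {S} x∉S with lookup S x in eq
... | true  = contradiction (Vec.lookup⇒[]= x S eq) x∉S
... | false = refl

lookup⇒∉ : ∀ {x : Fin n} {S} → lookup S x ≡ false → x ∉ S
lookup⇒∉ eq x∈S = case trans (sym (Vec.[]=⇒lookup x∈S)) eq of λ ()

⊕-⊆ : ∀ {α β S : Subset n} → α ⊆ S → β ⊆ S → α ⊕ β ⊆ S
⊕-⊆ {α = α} {β} {S} α⊆S β⊆S {x} x∈ with x Subset.∈? α | x Subset.∈? β
... | yes x∈α | _       = α⊆S x∈α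
... | no  _   | yes x∈β = β⊆S x∈β
... | no  x∉α | no  x∉β = contradiction x∈ (lookup⇒∉ (trans
        (Vec.lookup-zipWith _xor_ x α β) (cong₂ _xor_ (∉⇒lookup x∉α) (∉⇒lookup x∉β))))

spans-⊕ : ∀ (S : Subset n) (V : Vec (Vec Bool d) n) v w →
          spans S V v ≡ true → spans S V w ≡ true → spans S V (v ⊕ w) ≡ true
spans-⊕ S V v w sv sw with spans-sound S V v sv | spans-sound S V w sw
... | α , α⊆S , refl | β , β⊆S , refl =
  subst (λ u → spans S V u ≡ true) (total-⊕ α β V) (spans-complete S V (⊕-⊆ α⊆S β⊆S))

-- Crown-free families

infix 4 _⋖_

_⋖_ : Subset n → Subset n → Set
A ⋖ B = A ⊆ B × ∣ B ∣ ≡ suc ∣ A ∣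

⋖-unique : A ⋖ B → ∀ {e f} → e ∈ B → e ∉ A → f ∈ B → f ∉ A → e ≡ f
⋖-unique {A = A} {B = B} (A⊆B , ∣B∣) {e} {f} e∈B e∉A f∈B f∉A with e Fin.≟ f
... | yes e≡f = e≡f
... | no  e≢f = contradiction ∣B∣ (ℕ.<⇒≢ (begin-strict
    suc ∣ A ∣              ≤⟨ ℕ.s≤s (Subset.p⊆q⇒∣p∣≤∣q∣ A⊆) ⟩
    suc ∣ (B ∖ e) ∖ f ∣    ≤⟨ Subset.x∈p⇒∣p-x∣<∣p∣ (Subset.x∈p∧x≢y⇒x∈p-y f∈B (e≢f ∘ sym)) ⟩
    ∣ B ∖ e ∣              <⟨ Subset.x∈p⇒∣p-x∣<∣p∣ e∈B ⟩
    ∣ B ∣                  ∎) ∘ sym)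
  where
  open ℕ.≤-Reasoning
  A⊆ : A ⊆ (B ∖ e) ∖ f
  A⊆ x∈A = Subset.x∈p∧x≢y⇒x∈p-y
    (Subset.x∈p∧x≢y⇒x∈p-y (A⊆B x∈A) λ { refl → e∉A x∈A }) λ { refl → f∉A x∈A }

-- Each of the two lower sets misses a single element of `B`; if both missed `e`, they would
-- coincide.
⋖-join : A ⋖ B → A′ ⋖ B → A ≢ A′ → ∀ {e} → e ∈ B → e ∉ A → e ∈ A′
⋖-join {A = A} {B = B} {A′ = A′} A⋖B A′⋖B A≢A′ {e} e∈B e∉A with e Subset.∈? A′
... | yes e∈A′ = e∈A′
... | no  e∉A′ = contradiction
    (Subset.⊆-antisym (λ f∈A → sub A′⋖B e∉A′ (proj₁ A⋖B f∈A) λ { refl → e∉A f∈A })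
                      (λ f∈A′ → sub A⋖B e∉A (proj₁ A′⋖B f∈A′) λ { refl → e∉A′ f∈A′ })) A≢A′
  where
  sub : ∀ {C} → C ⋖ B → e ∉ C → ∀ {f} → f ∈ B → f ≢ e → f ∈ C
  sub {C} C⋖B e∉C {f} f∈B f≢e with f Subset.∈? C
  ... | yes f∈C = f∈C
  ... | no  f∉C = contradiction (⋖-unique C⋖B f∈B f∉C e∈B e∉C) f≢e

-- Both upper sets are `A` together with `e`.
⋖-meet : A ⋖ B → A ⋖ B′ → ∀ {e} → e ∈ B → e ∈ B′ → e ∉ A → B ≡ B′
⋖-meet {A = A} A⋖B A⋖B′ {e} e∈B e∈B′ e∉A = Subset.⊆-antisym (sub A⋖B e∈B A⋖B′ e∈B′) (sub A⋖B′ e∈B′ A⋖B e∈B)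
  where
  sub : ∀ {C C′} → A ⋖ C → e ∈ C → A ⋖ C′ → e ∈ C′ → C ⊆ C′
  sub A⋖C e∈C A⋖C′ e∈C′ {f} f∈C with f Subset.∈? A
  ... | yes f∈A = proj₁ A⋖C′ f∈A
  ... | no  f∉A = subst (_∈ _) (⋖-unique A⋖C e∈C e∉A f∈C f∉A) e∈C′

module _ (V : Vec (Vec Bool d) n) (w : Vec Bool d) where

  private
    Spans = λ S → spans S V w ≡ true

    -- A selection that avoids the one element of `B` outside `A` would already lie in `A`, and `A`
    -- would span `w`.
    new-element : ∀ {A B α : Subset n} → A ⋖ B → ¬ Spans A → α ⊆ B → total α V ≡ w →
                  ∀ {e} → e ∈ B → e ∉ A → e ∈ α
    new-element {A} {B} {α} A⋖B ¬A α⊆B tot {e} e∈B e∉A with e Subset.∈? α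
    ... | yes e∈α = e∈α
    ... | no  e∉α = contradiction
      (subst (λ u → spans A V u ≡ true) tot (spans-complete A V α⊆A)) ¬A
      where
      α⊆A : α ⊆ A
      α⊆A {f} f∈α with f Subset.∈? A
      ... | yes f∈A = f∈A
      ... | no  f∉A = contradiction (subst (_∈ α) (⋖-unique A⋖B (α⊆B f∈α) f∉A e∈B e∉A) f∈α) e∉α

  no-crown : ∀ {A₁ A₂ A₃ B₁₂ B₁₃ B₂₃ : Subset n} →
             A₁ ⋖ B₁₂ → A₁ ⋖ B₁₃ → A₂ ⋖ B₁₂ → A₂ ⋖ B₂₃ → A₃ ⋖ B₁₃ → A₃ ⋖ B₂₃ →
             A₁ ≢ A₂ → A₁ ≢ A₃ → A₂ ≢ A₃ → B₁₂ ≢ B₁₃ →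
             ¬ Spans A₁ → ¬ Spans A₂ → ¬ Spans A₃ →
             Spans B₁₂ → Spans B₁₃ → Spans B₂₃ → ⊥
  no-crown {A₁} {A₂} {A₃} {B₁₂} {B₁₃} {B₂₃} 1<12 1<13 2<12 2<23 3<13 3<23 1≢2 1≢3 2≢3 12≢13
           ¬1 ¬2 ¬3 s12 s13 s23
    with spans-sound B₁₂ V w s12 | spans-sound B₁₃ V w s13 | spans-sound B₂₃ V w s23
  ... | α , α⊆ , tα | β , β⊆ , tβ | γ , γ⊆ , tγ =
    ¬1 (subst (λ u → spans A₁ V u ≡ true) total-δ (spans-complete A₁ V δ⊆A₁))
    where
    δ = α ⊕ (β ⊕ γ)
    total-δ : total δ V ≡ w
    total-δ = begin
      total (α ⊕ (β ⊕ γ)) V               ≡⟨ total-⊕ α (β ⊕ γ) V ⟩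
      total α V ⊕ total (β ⊕ γ) V         ≡⟨ cong (total α V ⊕_) (total-⊕ β γ V) ⟩
      total α V ⊕ (total β V ⊕ total γ V) ≡⟨ cong₂ _⊕_ tα (cong₂ _⊕_ tβ tγ) ⟩
      w ⊕ (w ⊕ w)                         ≡⟨ ⊕-cancelˡ w w ⟩
      w                                   ∎
      where open ≡-Reasoning
    δ-lookup : ∀ e → lookup δ e ≡ lookup α e xor (lookup β e xor lookup γ e)
    δ-lookup e = trans (Vec.lookup-zipWith _xor_ e α (β ⊕ γ))
                       (cong (lookup α e xor_) (Vec.lookup-zipWith _xor_ e β γ))
    ∈⁺ : ∀ {e} {S : Subset n} → e ∈ S → lookup S e ≡ true
    ∈⁺ = Vec.[]=⇒lookup
    ∉⁺ : ∀ {e} {C S : Subset n} → S ⊆ C → e ∉ C → lookup S e ≡ false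
    ∉⁺ S⊆C e∉C = ∉⇒lookup (e∉C ∘ S⊆C)
    -- Outside `A₁`, each `e` belongs to none or to exactly two of the selections. If `e` lies in
    -- `B₁₂` but not in `B₁₃`, then it lies in `A₂`, hence in `B₂₃`, and not in `A₃`; so it is the
    -- new element both of `B₁₂` over `A₁` and of `B₂₃` over `A₃`. The case of `B₁₃` is symmetric,
    -- and `⋖-meet` excludes both at once.
    δ-vanishes : ∀ e → e ∉ A₁ → lookup α e xor (lookup β e xor lookup γ e) ≡ false
    δ-vanishes e e∉₁ with e Subset.∈? B₁₂ | e Subset.∈? B₁₃
    ... | yes ∈12 | yes ∈13 = contradiction (⋖-meet 1<12 1<13 ∈12 ∈13 e∉₁) 12≢13
    ... | no  ∉12 | no  ∉13 = cong₂ _xor_ (∉⁺ α⊆ ∉12) (cong₂ _xor_ (∉⁺ β⊆ ∉13) (∉⁺ γ⊆ ∉23))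
      where
      ∉23 : e ∉ B₂₃
      ∉23 ∈23 = ∉13 (proj₁ 3<13 (⋖-join 2<23 3<23 2≢3 ∈23 (∉12 ∘ proj₁ 2<12)))
    ... | yes ∈12 | no  ∉13 = cong₂ _xor_ (∈⁺ (new-element 1<12 ¬1 α⊆ tα ∈12 e∉₁))
        (cong₂ _xor_ (∉⁺ β⊆ ∉13) (∈⁺ (new-element 3<23 ¬3 γ⊆ tγ ∈23 (∉13 ∘ proj₁ 3<13))))
      where
      ∈23 = proj₁ 2<23 (⋖-join 1<12 2<12 1≢2 ∈12 e∉₁)
    ... | no  ∉12 | yes ∈13 = cong₂ _xor_ (∉⁺ α⊆ ∉12)
        (cong₂ _xor_ (∈⁺ (new-element 1<13 ¬1 β⊆ tβ ∈13 e∉₁))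
                     (∈⁺ (new-element 2<23 ¬2 γ⊆ tγ ∈23 (∉12 ∘ proj₁ 2<12))))
      where
      ∈23 = proj₁ 3<23 (⋖-join 1<13 3<13 1≢3 ∈13 e∉₁)
    δ⊆A₁ : δ ⊆ A₁
    δ⊆A₁ {e} e∈δ with e Subset.∈? A₁
    ... | yes e∈ = e∈
    ... | no  e∉ = contradiction e∈δ (lookup⇒∉ (trans (δ-lookup e) (δ-vanishes e e∉)))

-- The two-level family of given vectors and target

⊆∧≥⇒≡ : ∀ (A B : Subset n) → A ⊆ B → ∣ B ∣ ℕ.≤ ∣ A ∣ → A ≡ B
⊆∧≥⇒≡ []          []          A⊆B B≤A = refl
⊆∧≥⇒≡ (true  ∷ A) (true  ∷ B) A⊆B B≤A = cong (true ∷_) (⊆∧≥⇒≡ A B (Subset.drop-∷-⊆ A⊆B) (ℕ.s≤s⁻¹ B≤A))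
⊆∧≥⇒≡ (false ∷ A) (false ∷ B) A⊆B B≤A = cong (false ∷_) (⊆∧≥⇒≡ A B (Subset.drop-∷-⊆ A⊆B) B≤A)
⊆∧≥⇒≡ (true  ∷ A) (false ∷ B) A⊆B B≤A = case A⊆B Vec.here of λ ()
⊆∧≥⇒≡ (false ∷ A) (true  ∷ B) A⊆B B≤A =
  contradiction B≤A (ℕ.<⇒≱ (ℕ.s≤s (Subset.p⊆q⇒∣p∣≤∣q∣ (Subset.drop-∷-⊆ A⊆B))))

level : ∀ n → ℕ → List (Subset n)
level zero    zero    = [] ∷ []
level zero    (suc k) = []
level (suc n) zero    = List.map (false ∷_) (level n zero)
level (suc n) (suc k) = List.map (true ∷_) (level n k) ++ List.map (false ∷_) (level n (suc k))

length-level : ∀ n k → length (level n k) ≡ n C k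
length-level zero    zero    = refl
length-level zero    (suc k) = refl
length-level (suc n) zero    = trans (List.length-map (false ∷_) (level n 0)) (length-level n 0)
length-level (suc n) (suc k) = begin
  length (level (suc n) (suc k))
    ≡⟨ List.length-++ (List.map (true ∷_) (level n k)) ⟩
  length (List.map (true ∷_) (level n k)) ℕ.+ length (List.map (false ∷_) (level n (suc k)))
    ≡⟨ cong₂ ℕ._+_ (List.length-map (true ∷_) (level n k)) (List.length-map (false ∷_) (level n (suc k))) ⟩
  length (level n k) ℕ.+ length (level n (suc k))
    ≡⟨ cong₂ ℕ._+_ (length-level n k) (length-level n (suc k)) ⟩
  n C k ℕ.+ n C suc k
    ≡⟨ nCk+nC[k+1]≡[n+1]C[k+1] n k ⟩
  suc n C suc k ∎
  where open ≡-Reasoning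

level-size : ∀ n k → All (λ S → ∣ S ∣ ≡ k) (level n k)
level-size zero    zero    = refl ∷ []
level-size zero    (suc k) = []
level-size (suc n) zero    = All.map⁺ (level-size n 0)
level-size (suc n) (suc k) =
  All.++⁺ (All.map⁺ (All.map (cong suc) (level-size n k))) (All.map⁺ (level-size n (suc k)))

level-unique : ∀ n k → Unique (level n k)
level-unique zero    zero    = [] ∷ []
level-unique zero    (suc k) = []
level-unique (suc n) zero    = Unique.map⁺ Vec.∷-injectiveʳ (level-unique n 0)
level-unique (suc n) (suc k) =
  Unique.++⁺ (Unique.map⁺ Vec.∷-injectiveʳ (level-unique n k))
             (Unique.map⁺ Vec.∷-injectiveʳ (level-unique n (suc k)))
             λ { (∈₁ , ∈₂) → case (List.∈-map⁻ (true ∷_) ∈₁ , List.∈-map⁻ (false ∷_) ∈₂)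
                               of λ { ((_ , _ , refl) , (_ , _ , ())) } }

module _ (k : ℕ) (V : Vec (Vec Bool d) n) (w : Vec Bool d) where

  lower upper : List (Subset n)
  lower = filterᵇ (λ S → not (spans S V w)) (level n k)
  upper = filterᵇ (λ S → spans S V w) (level n (suc k))

  private
    T⇒≡ : ∀ {b} → T b → b ≡ true
    T⇒≡ {true} _ = refl

    not-true : ∀ {b} → T (not b) → b ≢ true
    not-true {false} _ ()

  ∈lower⁻ : ∀ {S} → S List.∈ lower → ∣ S ∣ ≡ k × spans S V w ≢ true
  ∈lower⁻ S∈ with ∈lev , t ← List.∈-filter⁻ (T? ∘ λ S → not (spans S V w)) S∈ =
    All.lookup (level-size n k) ∈lev , not-true t

  ∈upper⁻ : ∀ {S} → S List.∈ upper → ∣ S ∣ ≡ suc k × spans S V w ≡ true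
  ∈upper⁻ S∈ with ∈lev , t ← List.∈-filter⁻ (T? ∘ λ S → spans S V w) S∈ =
    All.lookup (level-size n (suc k)) ∈lev , T⇒≡ t

  spanFamily : Family n
  spanFamily = family (lower ++ upper)
    (Unique.++⁺ (Unique.filter⁺ _ (level-unique n k)) (Unique.filter⁺ _ (level-unique n (suc k)))
      λ (∈l , ∈u) → ℕ.1+n≢n (trans (sym (proj₁ (∈upper⁻ ∈u))) (proj₁ (∈lower⁻ ∈l))))

  -- Proper inclusion forces a strict increase in size, and only two sizes occur. A weak copy of the
  -- crown therefore has all its lower elements on level k and all its upper ones on level k+1, and
  -- each relation becomes a covering.
  ⊂-spanFamily : ∀ {A B} → A ∈ᶠ spanFamily → B ∈ᶠ spanFamily → A ⊆ B → A ≢ B →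
                 A ⋖ B × spans A V w ≢ true × spans B V w ≡ true
  ⊂-spanFamily {A} {B} A∈ B∈ A⊆B A≢B with List.∈-++⁻ lower A∈ | List.∈-++⁻ lower B∈
  ... | inj₁ a | inj₂ b =
    let ∣A∣≡k , ¬sA = ∈lower⁻ a
        ∣B∣≡1+k , sB = ∈upper⁻ b
    in (A⊆B , trans ∣B∣≡1+k (cong suc (sym ∣A∣≡k))) , ¬sA , sB
  ... | inj₁ a | inj₁ b = contradiction (⊆∧≥⇒≡ A B A⊆B
    (ℕ.≤-reflexive (trans (proj₁ (∈lower⁻ b)) (sym (proj₁ (∈lower⁻ a)))))) A≢B
  ... | inj₂ a | inj₂ b = contradiction (⊆∧≥⇒≡ A B A⊆B
    (ℕ.≤-reflexive (trans (proj₁ (∈upper⁻ b)) (sym (proj₁ (∈upper⁻ a)))))) A≢B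
  ... | inj₂ a | inj₁ b = contradiction (⊆∧≥⇒≡ A B A⊆B
    (subst₂ ℕ._≤_ (sym (proj₁ (∈lower⁻ b))) (sym (proj₁ (∈upper⁻ a))) (ℕ.n≤1+n k))) A≢B

  spanFamily-free : IsFree O₆ spanFamily
  spanFamily-free 𝓖 𝓖⊆ (ψ , mono) =
    no-crown V w (⋖′ a₁≺b₁₂) (⋖′ a₁≺b₁₃) (⋖′ a₂≺b₁₂) (⋖′ a₂≺b₂₃) (⋖′ a₃≺b₁₃) (⋖′ a₃≺b₂₃)
      (ψ-≢ λ ()) (ψ-≢ λ ()) (ψ-≢ λ ()) (ψ-≢ λ ())
      (below a₁≺b₁₂) (below a₂≺b₁₂) (below a₃≺b₁₃)
      (above a₁≺b₁₂) (above a₁≺b₁₃) (above a₂≺b₂₃)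
    where
    image : Crown → Subset n
    image p = proj₁ (Bijection.to ψ p)
    ψ-≢ : ∀ {p q} → p ≢ q → image p ≢ image q
    ψ-≢ p≢q eq = p≢q (Bijection.injective ψ (Σ-≡,≡→≡ (eq , unique⇒irrelevant (Family.unique 𝓖) _ _)))
    ≺⇒≢ : ∀ {p q} → p ≺ q → p ≢ q
    ≺⇒≢ () refl
    facts : ∀ {p q} → p ≺ q →
            image p ⋖ image q × spans (image p) V w ≢ true × spans (image q) V w ≡ true
    facts {p} {q} p≺q = ⊂-spanFamily (𝓖⊆ (proj₂ (Bijection.to ψ p))) (𝓖⊆ (proj₂ (Bijection.to ψ q)))
      (mono (inj₁ p≺q)) (ψ-≢ (≺⇒≢ p≺q))
    ⋖′ : ∀ {p q} → p ≺ q → image p ⋖ image q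
    ⋖′ = proj₁ ∘ facts
    below : ∀ {p q} → p ≺ q → spans (image p) V w ≢ true
    below = proj₁ ∘ proj₂ ∘ facts
    above : ∀ {p q} → p ≺ q → spans (image q) V w ≡ true
    above = proj₂ ∘ proj₂ ∘ facts

  ∣spanFamily∣≤La : ∣ spanFamily ∣ᶠ ℕ.≤ La n O₆
  ∣spanFamily∣≤La = IsMaximum.upperBound (proj₂ (La-exists n O₆)) (spanFamily , spanFamily-free , refl)

-- Rational arithmetic

toℚᵘ-/ : ∀ p k .{{_ : ℕ.NonZero k}} → ℚ.toℚᵘ (p / k) ℚᵘ.≃ (p ℚᵘ./ k)
toℚᵘ-/ p (suc k) = ℚ.toℚᵘ-fromℚᵘ (p ℚᵘ./ suc k)

ι : ℕ → ℚ
ι k = + k / 1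

recip : ∀ k → .{{ℕ.NonZero k}} → ℚ
recip k = + 1 / k

ι-+ : ∀ a b → ι (a ℕ.+ b) ≡ ι a + ι b
ι-+ a b = ℚ.toℚᵘ-injective (begin
  ℚ.toℚᵘ (ι (a ℕ.+ b))                       ≈⟨ toℚᵘ-/ (+ (a ℕ.+ b)) 1 ⟩
  + (a ℕ.+ b) ℚᵘ./ 1                         ≈⟨ ℚᵘ.*≡* (cong (ℤ._* + 1) (sym (cong₂ ℤ._+_ (ℤ.*-identityʳ (+ a)) (ℤ.*-identityʳ (+ b))))) ⟩
  (+ a ℚᵘ./ 1) ℚᵘ.+ (+ b ℚᵘ./ 1)             ≈⟨ ℚᵘ.+-cong (toℚᵘ-/ (+ a) 1) (toℚᵘ-/ (+ b) 1) ⟨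
  ℚ.toℚᵘ (ι a) ℚᵘ.+ ℚ.toℚᵘ (ι b)             ≈⟨ ℚ.toℚᵘ-homo-+ (ι a) (ι b) ⟨
  ℚ.toℚᵘ (ι a + ι b)                         ∎)
  where open ℚᵘ.≃-Reasoning

ι-* : ∀ a b → ι (a ℕ.* b) ≡ ι a * ι b
ι-* a b = ℚ.toℚᵘ-injective (begin
  ℚ.toℚᵘ (ι (a ℕ.* b))                       ≈⟨ toℚᵘ-/ (+ (a ℕ.* b)) 1 ⟩
  + (a ℕ.* b) ℚᵘ./ 1                         ≈⟨ ℚᵘ.*≡* (cong (ℤ._* + 1) (ℤ.pos-* a b)) ⟩
  (+ a ℚᵘ./ 1) ℚᵘ.* (+ b ℚᵘ./ 1)             ≈⟨ ℚᵘ.*-cong (toℚᵘ-/ (+ a) 1) (toℚᵘ-/ (+ b) 1) ⟨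
  ℚ.toℚᵘ (ι a) ℚᵘ.* ℚ.toℚᵘ (ι b)             ≈⟨ ℚ.toℚᵘ-homo-* (ι a) (ι b) ⟨
  ℚ.toℚᵘ (ι a * ι b)                         ∎)
  where open ℚᵘ.≃-Reasoning

ι-mono : ∀ {a b} → a ℕ.≤ b → ι a ≤ ι b
ι-mono {a} {b} a≤b = ℚ.toℚᵘ-cancel-≤
  (ℚᵘ.≤-respˡ-≃ (ℚᵘ.≃-sym (toℚᵘ-/ (+ a) 1))
  (ℚᵘ.≤-respʳ-≃ (ℚᵘ.≃-sym (toℚᵘ-/ (+ b) 1))
    (ℚᵘ.*≤* (ℤ.*-monoʳ-≤-nonNeg (+ 1) (ℤ.+≤+ a≤b)))))

recip-* : ∀ a b .{{_ : ℕ.NonZero a}} .{{_ : ℕ.NonZero b}} .{{_ : ℕ.NonZero (a ℕ.* b)}} →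
          recip (a ℕ.* b) ≡ recip a * recip b
recip-* a@(suc _) b@(suc _) = ℚ.toℚᵘ-injective (begin
  ℚ.toℚᵘ (recip (a ℕ.* b))                   ≈⟨ toℚᵘ-/ (+ 1) (a ℕ.* b) ⟩
  + 1 ℚᵘ./ (a ℕ.* b)                         ≈⟨ ℚᵘ.*≡* refl ⟩
  (+ 1 ℚᵘ./ a) ℚᵘ.* (+ 1 ℚᵘ./ b)             ≈⟨ ℚᵘ.*-cong (toℚᵘ-/ (+ 1) a) (toℚᵘ-/ (+ 1) b) ⟨
  ℚ.toℚᵘ (recip a) ℚᵘ.* ℚ.toℚᵘ (recip b)     ≈⟨ ℚ.toℚᵘ-homo-* (recip a) (recip b) ⟨
  ℚ.toℚᵘ (recip a * recip b)                 ∎)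
  where open ℚᵘ.≃-Reasoning

recip-ι : ∀ k .{{_ : ℕ.NonZero k}} → recip k * ι k ≡ 1ℚ
recip-ι k@(suc k-1) = ℚ.toℚᵘ-injective (begin
  ℚ.toℚᵘ (recip k * ι k)                     ≈⟨ ℚ.toℚᵘ-homo-* (recip k) (ι k) ⟩
  ℚ.toℚᵘ (recip k) ℚᵘ.* ℚ.toℚᵘ (ι k)         ≈⟨ ℚᵘ.*-cong (toℚᵘ-/ (+ 1) k) (toℚᵘ-/ (+ k) 1) ⟩
  (+ 1 ℚᵘ./ k) ℚᵘ.* (+ k ℚᵘ./ 1)             ≈⟨ ℚᵘ.*≡* (trans (ℤ.*-identityʳ _) (cong (λ m → + (1 ℕ.* m)) (sym (ℕ.*-identityʳ k)))) ⟩
  ℚ.toℚᵘ 1ℚ                                  ∎)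
  where open ℚᵘ.≃-Reasoning

recip>0 : ∀ k .{{_ : ℕ.NonZero k}} → 0ℚ < recip k
recip>0 k = ℚ.positive⁻¹ (recip k) {{ℚ.normalize-pos 1 k}}

2^-suc : ∀ i → 2^- suc i ≡ ½ * 2^- i
2^-suc i = recip-* 2 (2 ℕ.^ i) {{_}} {{ℕ.m^n≢0 2 i}} {{ℕ.m^n≢0 2 (suc i)}}

2^-+ : ∀ i j → 2^- (i ℕ.+ j) ≡ 2^- i * 2^- j
2^-+ zero    j = sym (ℚ.*-identityˡ (2^- j))
2^-+ (suc i) j = begin
  2^- suc (i ℕ.+ j)        ≡⟨ 2^-suc (i ℕ.+ j) ⟩
  ½ * 2^- (i ℕ.+ j)        ≡⟨ cong (½ *_) (2^-+ i j) ⟩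
  ½ * (2^- i * 2^- j)      ≡⟨ ℚ.*-assoc ½ (2^- i) (2^- j) ⟨
  (½ * 2^- i) * 2^- j      ≡⟨ cong (_* 2^- j) (2^-suc i) ⟨
  2^- suc i * 2^- j        ∎
  where open ≡-Reasoning

2^->0 : ∀ i → 0ℚ < 2^- i
2^->0 i = recip>0 (2 ℕ.^ i) {{ℕ.m^n≢0 2 i}}

2^-suc-double : ∀ i → 2^- suc i + 2^- suc i ≡ 2^- i
2^-suc-double i = trans (cong₂ _+_ (2^-suc i) (2^-suc i))
  (solve 1 (λ x → con ½ :* x :+ con ½ :* x := x) refl (2^- i))

-- Averages over finite sets

record Mean (X : Set) : Set where
  field
    𝔼       : (X → ℚ) → ℚ
    𝔼-mono  : ∀ {f g} → (∀ x → f x ≤ g x) → 𝔼 f ≤ 𝔼 g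
    𝔼-const : ∀ q → 𝔼 (const q) ≡ q
    𝔼-+     : ∀ f g → 𝔼 (λ x → f x + g x) ≡ 𝔼 f + 𝔼 g
    𝔼-*     : ∀ q f → 𝔼 (λ x → q * f x) ≡ q * 𝔼 f

  𝔼-cong : ∀ {f g} → (∀ x → f x ≡ g x) → 𝔼 f ≡ 𝔼 g
  𝔼-cong eq = ℚ.≤-antisym (𝔼-mono (ℚ.≤-reflexive ∘ eq)) (𝔼-mono (ℚ.≤-reflexive ∘ sym ∘ eq))

open Mean

𝔼bool : Mean Bool
𝔼bool .𝔼 f          = ½ * (f false + f true)
𝔼bool .𝔼-mono f≤g   = ℚ.*-monoˡ-≤-nonNeg ½ (ℚ.+-mono-≤ (f≤g false) (f≤g true))
𝔼bool .𝔼-const      = solve 1 (λ q → con ½ :* (q :+ q) := q) refl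
𝔼bool .𝔼-+ f g      =
  solve 4 (λ a b c d → con ½ :* ((a :+ b) :+ (c :+ d)) := con ½ :* (a :+ c) :+ con ½ :* (b :+ d))
    refl (f false) (g false) (f true) (g true)
𝔼bool .𝔼-* q f      =
  solve 3 (λ q a b → con ½ :* (q :* a :+ q :* b) := q :* (con ½ :* (a :+ b))) refl q (f false) (f true)

-- The head is averaged innermost, with the tail held fixed; this lets one condition on the span of
-- the tail when a vector is added in front.
𝔼vec : Mean X → ∀ n → Mean (Vec X n)
𝔼vec M zero .𝔼 f            = f []
𝔼vec M zero .𝔼-mono f≤g     = f≤g []
𝔼vec M zero .𝔼-const q      = refl
𝔼vec M zero .𝔼-+ f g        = refl
𝔼vec M zero .𝔼-* q f        = refl
𝔼vec M (suc n) .𝔼 f         = 𝔼vec M n .𝔼 λ V → M .𝔼 λ v → f (v ∷ V)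
𝔼vec M (suc n) .𝔼-mono f≤g  = 𝔼vec M n .𝔼-mono λ V → M .𝔼-mono λ v → f≤g (v ∷ V)
𝔼vec M (suc n) .𝔼-const q   = trans (𝔼-cong (𝔼vec M n) λ _ → M .𝔼-const q) (𝔼vec M n .𝔼-const q)
𝔼vec M (suc n) .𝔼-+ f g     = trans (𝔼-cong (𝔼vec M n) λ _ → M .𝔼-+ _ _) (𝔼vec M n .𝔼-+ _ _)
𝔼vec M (suc n) .𝔼-* q f     = trans (𝔼-cong (𝔼vec M n) λ _ → M .𝔼-* q _) (𝔼vec M n .𝔼-* q _)

𝔼cube : ∀ d → Mean (Vec Bool d)
𝔼cube = 𝔼vec 𝔼bool

𝔼vectors : ∀ d n → Mean (Vec (Vec Bool d) n)
𝔼vectors d = 𝔼vec (𝔼cube d)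

𝔼bool-xor : ∀ b (f : Bool → ℚ) → 𝔼bool .𝔼 (λ x → f (b xor x)) ≡ 𝔼bool .𝔼 f
𝔼bool-xor false f = refl
𝔼bool-xor true  f = cong (½ *_) (ℚ.+-comm (f true) (f false))

-- Translation invariance of the uniform average: a coset of a span has the same density as the
-- span.
𝔼cube-⊕ : ∀ (v : Vec Bool d) f → 𝔼cube d .𝔼 (λ w → f (v ⊕ w)) ≡ 𝔼cube d .𝔼 f
𝔼cube-⊕ []              f = refl
𝔼cube-⊕ {suc d} (b ∷ v) f =
  trans (𝔼-cong (𝔼cube d) λ w → 𝔼bool-xor b λ x → f (x ∷ v ⊕ w)) (𝔼cube-⊕ v _)

-- Density of the span of random vectors

𝟙 : Bool → ℚ
𝟙 b = if b then 1ℚ else 0ℚ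

𝔼-isZero : ∀ d → 𝔼cube d .𝔼 (𝟙 ∘ isZero) ≡ 2^- d
𝔼-isZero zero    = refl
𝔼-isZero (suc d) = begin
  𝔼cube d .𝔼 (λ w → ½ * (𝟙 (isZero w) + 0ℚ))   ≡⟨ 𝔼-* (𝔼cube d) ½ _ ⟩
  ½ * 𝔼cube d .𝔼 (λ w → 𝟙 (isZero w) + 0ℚ)     ≡⟨ cong (½ *_) (𝔼-cong (𝔼cube d) λ w → ℚ.+-identityʳ _) ⟩
  ½ * 𝔼cube d .𝔼 (𝟙 ∘ isZero)                  ≡⟨ cong (½ *_) (𝔼-isZero d) ⟩
  ½ * 2^- d                                     ≡⟨ 2^-suc d ⟨
  2^- suc d                                     ∎
  where open ≡-Reasoning

density : Subset n → Vec (Vec Bool d) n → ℚ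
density {d = d} S V = 𝔼cube d .𝔼 (𝟙 ∘ spans S V)

-- A new vector lies in a subspace of density x with probability x, and
-- otherwise doubles the subspace.
step : (ℚ → ℚ) → ℚ → ℚ
step φ x = x * φ x + (1ℚ - x) * φ (x + x)

-- The mean of `φ` at the density reached from `x` after `m` new vectors. The chain acts on test
-- functions (the backward equation), so no probability distribution on densities has to be
-- represented.
evolve : ℕ → (ℚ → ℚ) → ℚ → ℚ
evolve zero    φ = φ
evolve (suc m) φ = step (evolve m φ)

step-cong : ∀ {φ χ} → (∀ x → φ x ≡ χ x) → ∀ x → step φ x ≡ step χ x
step-cong eq x = cong₂ (λ a b → x * a + (1ℚ - x) * b) (eq x) (eq (x + x))

-- Averaging out the head vector replaces the test function by `step φ`, whereas `evolve` adds its
-- steps on the outside; the two orders agree.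
evolve-step : ∀ m φ x → evolve m (step φ) x ≡ evolve (suc m) φ x
evolve-step zero    φ x = refl
evolve-step (suc m) φ x = step-cong (evolve-step m φ) x

evolve-+ : ∀ m φ χ x → evolve m (λ x → φ x + χ x) x ≡ evolve m φ x + evolve m χ x
evolve-+ zero    φ χ x = refl
evolve-+ (suc m) φ χ x = trans (step-cong (evolve-+ m φ χ) x)
  (solve 5 (λ x a b a′ b′ → x :* (a :+ b) :+ (con 1ℚ :- x) :* (a′ :+ b′)
    := (x :* a :+ (con 1ℚ :- x) :* a′) :+ (x :* b :+ (con 1ℚ :- x) :* b′)) refl
    x (evolve m φ x) (evolve m χ x) (evolve m φ (x + x)) (evolve m χ (x + x)))

evolve-cong : ∀ m {φ χ} → (∀ x → φ x ≡ χ x) → ∀ x → evolve m φ x ≡ evolve m χ x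
evolve-cong zero    eq x = eq x
evolve-cong (suc m) eq x = step-cong (evolve-cong m eq) x

module _ (S : Subset n) (V : Vec (Vec Bool d) n) where

  private
    translate-∨ : ∀ v → spans S V v ≡ true → ∀ w → spans S V w ∨ spans S V (v ⊕ w) ≡ spans S V w
    translate-∨ v sv w with spans S V w in eq | spans S V (v ⊕ w) in eq′
    ... | true  | _     = refl
    ... | false | false = refl
    ... | false | true  = trans (sym (subst (λ u → spans S V u ≡ true) (⊕-cancelˡ v w)
                            (spans-⊕ S V v (v ⊕ w) sv eq′))) eq

    translate-disjoint : ∀ v → spans S V v ≡ false → ∀ w →
      𝟙 (spans S V w ∨ spans S V (v ⊕ w)) ≡ 𝟙 (spans S V w) + 𝟙 (spans S V (v ⊕ w))
    translate-disjoint v ¬sv w with spans S V w in eq | spans S V (v ⊕ w) in eq′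
    ... | true  | false = refl
    ... | false | b     = sym (ℚ.+-identityˡ (𝟙 b))
    ... | true  | true  = contradiction (trans (sym ¬sv) (subst (λ u → spans S V u ≡ true)
        (trans (⊕-comm w (v ⊕ w)) (trans (⊕-assoc v w w) (trans (cong (v ⊕_) (⊕-self w)) (⊕-identityʳ v))))
        (spans-⊕ S V w (v ⊕ w) eq eq′))) λ ()

  -- The new span is the union of the old one and its translate by `v`. These coincide if `v` was
  -- already spanned; otherwise they are disjoint and equally dense.
  density-∷ : ∀ v → density (true ∷ S) (v ∷ V) ≡
              (if spans S V v then density S V else density S V + density S V)
  density-∷ v with spans S V v in eq
  ... | true  = 𝔼-cong (𝔼cube d) λ w → cong 𝟙 (translate-∨ v eq w)
  ... | false = begin
    density (true ∷ S) (v ∷ V)                                     ≡⟨ 𝔼-cong (𝔼cube d) (translate-disjoint v eq) ⟩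
    𝔼cube d .𝔼 (λ w → 𝟙 (spans S V w) + 𝟙 (spans S V (v ⊕ w)))   ≡⟨ 𝔼-+ (𝔼cube d) _ _ ⟩
    density S V + 𝔼cube d .𝔼 (λ w → 𝟙 (spans S V (v ⊕ w)))       ≡⟨ cong (λ y → density S V + y) (𝔼cube-⊕ v (𝟙 ∘ spans S V)) ⟩
    density S V + density S V                                      ∎
    where open ≡-Reasoning

  𝔼-density-∷ : ∀ φ → 𝔼cube d .𝔼 (λ v → φ (density (true ∷ S) (v ∷ V))) ≡ step φ (density S V)
  𝔼-density-∷ φ = begin
    𝔼cube d .𝔼 (λ v → φ (density (true ∷ S) (v ∷ V)))
      ≡⟨ 𝔼-cong (𝔼cube d) (λ v → trans (cong φ (density-∷ v)) (interpolate (spans S V v))) ⟩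
    𝔼cube d .𝔼 (λ v → φ (x + x) + (φ x - φ (x + x)) * 𝟙 (spans S V v))
      ≡⟨ 𝔼-+ (𝔼cube d) _ _ ⟩
    𝔼cube d .𝔼 (const (φ (x + x))) + 𝔼cube d .𝔼 (λ v → (φ x - φ (x + x)) * 𝟙 (spans S V v))
      ≡⟨ cong₂ _+_ (𝔼-const (𝔼cube d) _) (𝔼-* (𝔼cube d) (φ x - φ (x + x)) _) ⟩
    φ (x + x) + (φ x - φ (x + x)) * x
      ≡⟨ solve 3 (λ x a b → b :+ (a :- b) :* x := x :* a :+ (con 1ℚ :- x) :* b) refl x (φ x) (φ (x + x)) ⟩
    step φ x ∎
    where
    open ≡-Reasoning
    x = density S V
    -- Affine in the indicator of `v` being spanned, so linearity of the average replaces that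
    -- indicator by the density `x`.
    interpolate : ∀ b → φ (if b then x else x + x) ≡ φ (x + x) + (φ x - φ (x + x)) * 𝟙 b
    interpolate true  = solve 2 (λ a b → a := b :+ (a :- b) :* con 1ℚ) refl (φ x) (φ (x + x))
    interpolate false = solve 2 (λ a b → b := b :+ (a :- b) :* con 0ℚ) refl (φ x) (φ (x + x))

𝔼-density : ∀ (S : Subset n) d φ → 𝔼vectors d n .𝔼 (λ V → φ (density S V)) ≡ evolve ∣ S ∣ φ (2^- d)
𝔼-density []          d φ = cong φ (𝔼-isZero d)
𝔼-density {suc n} (false ∷ S) d φ =
  trans (𝔼-cong (𝔼vectors d n) λ V → 𝔼-const (𝔼cube d) _) (𝔼-density S d φ)
𝔼-density {suc n} (true ∷ S) d φ = begin
  𝔼vectors d n .𝔼 (λ V → 𝔼cube d .𝔼 λ v → φ (density (true ∷ S) (v ∷ V)))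
    ≡⟨ 𝔼-cong (𝔼vectors d n) (λ V → 𝔼-density-∷ S V φ) ⟩
  𝔼vectors d n .𝔼 (λ V → step φ (density S V))
    ≡⟨ 𝔼-density S d (step φ) ⟩
  evolve ∣ S ∣ (step φ) (2^- d)
    ≡⟨ evolve-step ∣ S ∣ φ (2^- d) ⟩
  evolve (suc ∣ S ∣) φ (2^- d) ∎
  where open ≡-Reasoning

-- Expected size of the family

𝔼-filter : ∀ {Y : Set} (M : Mean X) (p : X → Y → Bool) q {ys} →
           All (λ y → M .𝔼 (λ x → 𝟙 (p x y)) ≡ q) ys →
           M .𝔼 (λ x → ι (length (filterᵇ (p x) ys))) ≡ ι (length ys) * q
𝔼-filter M p q {[]} [] = trans (𝔼-const M 0ℚ) (sym (ℚ.*-zeroˡ q))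
𝔼-filter M p q {y ∷ ys} (eq ∷ eqs) = begin
  M .𝔼 (λ x → ι (length (filterᵇ (p x) (y ∷ ys))))
    ≡⟨ 𝔼-cong M split ⟩
  M .𝔼 (λ x → 𝟙 (p x y) + ι (length (filterᵇ (p x) ys)))
    ≡⟨ 𝔼-+ M _ _ ⟩
  M .𝔼 (λ x → 𝟙 (p x y)) + M .𝔼 (λ x → ι (length (filterᵇ (p x) ys)))
    ≡⟨ cong₂ _+_ eq (𝔼-filter M p q eqs) ⟩
  q + ι (length ys) * q
    ≡⟨ solve 2 (λ q l → q :+ l :* q := (con 1ℚ :+ l) :* q) refl q (ι (length ys)) ⟩
  (1ℚ + ι (length ys)) * q
    ≡⟨ cong (_* q) (ι-+ 1 (length ys)) ⟨
  ι (length (y ∷ ys)) * q ∎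
  where
  open ≡-Reasoning
  split : ∀ x → ι (length (filterᵇ (p x) (y ∷ ys))) ≡ 𝟙 (p x y) + ι (length (filterᵇ (p x) ys))
  split x with p x y
  ... | true  = ι-+ 1 (length (filterᵇ (p x) ys))
  ... | false = sym (ℚ.+-identityˡ _)

_⊗_ : ∀ {X Y} → Mean X → Mean Y → Mean (X × Y)
(M ⊗ N) .𝔼 f          = M .𝔼 λ x → N .𝔼 λ y → f (x , y)
(M ⊗ N) .𝔼-mono f≤g   = M .𝔼-mono λ x → N .𝔼-mono λ y → f≤g (x , y)
(M ⊗ N) .𝔼-const q    = trans (𝔼-cong M λ _ → N .𝔼-const q) (M .𝔼-const q)
(M ⊗ N) .𝔼-+ f g      = trans (𝔼-cong M λ _ → N .𝔼-+ _ _) (M .𝔼-+ _ _)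
(M ⊗ N) .𝔼-* q f      = trans (𝔼-cong M λ _ → N .𝔼-* q _) (M .𝔼-* q _)

spanProb : ℕ → ℕ → ℚ
spanProb d m = evolve m id (2^- d)

module _ (n d : ℕ) where

  𝔼config : Mean (Vec (Vec Bool d) n × Vec Bool d)
  𝔼config = 𝔼vectors d n ⊗ 𝔼cube d

  -- The inner average over `w` is `density S V` by definition, which makes this the case of the
  -- test function `id`.
  𝔼-spans : ∀ (S : Subset n) → 𝔼config .𝔼 (λ (V , w) → 𝟙 (spans S V w)) ≡ spanProb d ∣ S ∣
  𝔼-spans S = 𝔼-density S d id

  𝔼-¬spans : ∀ (S : Subset n) → 𝔼config .𝔼 (λ (V , w) → 𝟙 (not (spans S V w))) ≡ 1ℚ - spanProb d ∣ S ∣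
  𝔼-¬spans S = begin
    𝔼config .𝔼 (λ (V , w) → 𝟙 (not (spans S V w)))
      ≡⟨ 𝔼-cong 𝔼config (λ (V , w) → 𝟙-not (spans S V w)) ⟩
    𝔼config .𝔼 (λ (V , w) → 1ℚ + (ℚ.- 1ℚ) * 𝟙 (spans S V w))
      ≡⟨ 𝔼-+ 𝔼config _ _ ⟩
    𝔼config .𝔼 (const 1ℚ) + 𝔼config .𝔼 (λ (V , w) → (ℚ.- 1ℚ) * 𝟙 (spans S V w))
      ≡⟨ cong₂ _+_ (𝔼-const 𝔼config 1ℚ) (trans (𝔼-* 𝔼config (ℚ.- 1ℚ) _) (cong ((ℚ.- 1ℚ) *_) (𝔼-spans S))) ⟩
    1ℚ + (ℚ.- 1ℚ) * spanProb d ∣ S ∣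
      ≡⟨ solve 1 (λ p → con 1ℚ :+ con (ℚ.- 1ℚ) :* p := con 1ℚ :- p) refl (spanProb d ∣ S ∣) ⟩
    1ℚ - spanProb d ∣ S ∣ ∎
    where
    open ≡-Reasoning
    𝟙-not : ∀ b → 𝟙 (not b) ≡ 1ℚ + (ℚ.- 1ℚ) * 𝟙 b
    𝟙-not true  = refl
    𝟙-not false = refl

  𝔼-spanFamily : ∀ k → 𝔼config .𝔼 (λ (V , w) → ι ∣ spanFamily k V w ∣ᶠ)
                       ≡ ι (n C k) * (1ℚ - spanProb d k) + ι (n C suc k) * spanProb d (suc k)
  𝔼-spanFamily k = begin
    𝔼config .𝔼 (λ (V , w) → ι ∣ spanFamily k V w ∣ᶠ)
      ≡⟨ 𝔼-cong 𝔼config (λ (V , w) → trans (cong ι (List.length-++ (lower k V w)))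
                                            (ι-+ (length (lower k V w)) (length (upper k V w)))) ⟩
    𝔼config .𝔼 (λ (V , w) → ι (length (lower k V w)) + ι (length (upper k V w)))
      ≡⟨ 𝔼-+ 𝔼config _ _ ⟩
    𝔼config .𝔼 (λ (V , w) → ι (length (lower k V w))) + 𝔼config .𝔼 (λ (V , w) → ι (length (upper k V w)))
      ≡⟨ cong₂ _+_
          (𝔼-filter 𝔼config (λ (V , w) S → not (spans S V w)) (1ℚ - spanProb d k)
            (All.map (λ {S} size → trans (𝔼-¬spans S) (cong (λ m → 1ℚ - spanProb d m) size)) (level-size n k)))
          (𝔼-filter 𝔼config (λ (V , w) S → spans S V w) (spanProb d (suc k))
            (All.map (λ {S} size → trans (𝔼-spans S) (cong (spanProb d) size)) (level-size n (suc k)))) ⟩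
    ι (length (level n k)) * (1ℚ - spanProb d k) + ι (length (level n (suc k))) * spanProb d (suc k)
      ≡⟨ cong₂ (λ a b → ι a * (1ℚ - spanProb d k) + ι b * spanProb d (suc k))
               (length-level n k) (length-level n (suc k)) ⟩
    ι (n C k) * (1ℚ - spanProb d k) + ι (n C suc k) * spanProb d (suc k) ∎
    where open ≡-Reasoning

  -- Every configuration yields a free family, so its size is at most `La n O₆`; averaging this
  -- inequality gives the bound without selecting a good configuration.
  La-≥ : ∀ k → ι (n C k) * (1ℚ - spanProb d k) + ι (n C suc k) * spanProb d (suc k) ≤ ι (La n O₆)
  La-≥ k = subst₂ _≤_ (𝔼-spanFamily k) (𝔼-const 𝔼config (ι (La n O₆)))
    (𝔼-mono 𝔼config λ (V , w) → ι-mono (∣spanFamily∣≤La k V w))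

-- Inequalities and the partial products of Δ₂

*-monoˡ : ∀ {p a b} → 0ℚ ≤ p → a ≤ b → p * a ≤ p * b
*-monoˡ {p} p≥0 = ℚ.*-monoˡ-≤-nonNeg p {{ℚ.nonNegative p≥0}}

*-monoʳ : ∀ {p a b} → 0ℚ ≤ p → a ≤ b → a * p ≤ b * p
*-monoʳ {p} p≥0 = ℚ.*-monoʳ-≤-nonNeg p {{ℚ.nonNegative p≥0}}

*-≥0 : ∀ {p q} → 0ℚ ≤ p → 0ℚ ≤ q → 0ℚ ≤ p * q
*-≥0 {p} {q} p≥0 q≥0 = subst (_≤ p * q) (ℚ.*-zeroʳ p) (*-monoˡ p≥0 q≥0)

*->0 : ∀ {p q} → 0ℚ < p → 0ℚ < q → 0ℚ < p * q
*->0 {p} {q} p>0 q>0 = subst (_< p * q) (ℚ.*-zeroʳ p) (ℚ.*-monoʳ-<-pos p {{ℚ.positive p>0}} q>0)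

p≤q⇒0≤q-p : ∀ {p q} → p ≤ q → 0ℚ ≤ q - p
p≤q⇒0≤q-p {p} {q} p≤q = subst (_≤ q - p) (ℚ.+-inverseʳ p) (ℚ.+-monoˡ-≤ (ℚ.- p) p≤q)

0≤q-p⇒p≤q : ∀ {p q} → 0ℚ ≤ q - p → p ≤ q
0≤q-p⇒p≤q {p} {q} le = subst₂ _≤_ (ℚ.+-identityˡ p)
  (solve 2 (λ p q → (q :- p) :+ p := q) refl p q) (ℚ.+-monoˡ-≤ p le)

2^-≥0 : ∀ i → 0ℚ ≤ 2^- i
2^-≥0 i = ℚ.<⇒≤ (2^->0 i)

2^-suc≤ : ∀ i → 2^- suc i ≤ 2^- i
2^-suc≤ i = subst₂ _≤_ (ℚ.+-identityʳ (2^- suc i)) (2^-suc-double i) (ℚ.+-monoʳ-≤ (2^- suc i) (2^-≥0 (suc i)))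

2^-≤1 : ∀ i → 2^- i ≤ 1ℚ
2^-≤1 zero    = ℚ.≤-refl
2^-≤1 (suc i) = ℚ.≤-trans (2^-suc≤ i) (2^-≤1 i)

2^-suc<1 : ∀ i → 2^- suc i < 1ℚ
2^-suc<1 i = ℚ.<-≤-trans (subst₂ _<_ (ℚ.+-identityʳ (2^- suc i)) (2^-suc-double i)
  (ℚ.+-monoʳ-< (2^- suc i) (2^->0 (suc i)))) (2^-≤1 i)

-- Definitionally `ℝ.seq Δ₂ m`, hence `Q m * Σ₁ m summand` is `ℝ.seq c m`.
Q : ℕ → ℚ
Q m = Π₁ m (λ i → 1ℚ - 2^- i)

Q>0 : ∀ m → 0ℚ < Q m
Q>0 zero    = ℚ.positive⁻¹ 1ℚ
Q>0 (suc m) = *->0 (Q>0 m) (subst (_< 1ℚ - 2^- suc m) (ℚ.+-inverseʳ (2^- suc m))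
                              (ℚ.+-monoˡ-< (ℚ.- (2^- suc m)) (2^-suc<1 m)))

Q≥0 : ∀ m → 0ℚ ≤ Q m
Q≥0 = ℚ.<⇒≤ ∘ Q>0

Q-suc≤ : ∀ m → Q (suc m) ≤ Q m
Q-suc≤ m = 0≤q-p⇒p≤q (subst (0ℚ ≤_)
  (solve 2 (λ q t → q :* t := q :- q :* (con 1ℚ :- t)) refl (Q m) (2^- suc m))
  (*-≥0 (Q≥0 m) (2^-≥0 (suc m))))

Q-antitone : ∀ i m → Q (i ℕ.+ m) ≤ Q m
Q-antitone zero    m = ℚ.≤-refl
Q-antitone (suc i) m = ℚ.≤-trans (Q-suc≤ (i ℕ.+ m)) (Q-antitone i m)

Q≤1 : ∀ m → Q m ≤ 1ℚ
Q≤1 m = subst (λ k → Q k ≤ 1ℚ) (ℕ.+-identityʳ m) (Q-antitone m 0)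

-- A product of factors 1 - x with x in [0,1] is at least 1 minus the sum of the x, and the sum of
-- 2^-l over l > m does not exceed 2^-m.
Q-tail : ∀ i m → Q m * (1ℚ - 2^- m) ≤ Q (i ℕ.+ m)
Q-tail i m = ℚ.≤-trans (*-monoˡ (Q≥0 m) (0≤q-p⇒p≤q (subst (0ℚ ≤_)
    (solve 2 (λ a b → b := ((con 1ℚ :- a) :+ b) :- (con 1ℚ :- a)) refl (2^- m) (2^- (i ℕ.+ m)))
    (2^-≥0 (i ℕ.+ m))))) (strong i)
  where
  open ℚ.≤-Reasoning
  -- The surplus `2^- (i ℕ.+ m)` makes the induction work: it is the part of `2^- m` not yet
  -- consumed by the first i factors.
  strong : ∀ i → Q m * ((1ℚ - 2^- m) + 2^- (i ℕ.+ m)) ≤ Q (i ℕ.+ m)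
  strong zero = ℚ.≤-reflexive
    (solve 2 (λ q a → q :* ((con 1ℚ :- a) :+ a) := q) refl (Q m) (2^- m))
  strong (suc i) = begin
    q * (a + t)                ≡⟨ solve 3 (λ q a t → q :* (a :+ t) := q :* (a :+ (t :+ t)) :- q :* t) refl q a t ⟩
    q * (a + (t + t)) - q * t  ≡⟨ cong (λ y → q * (a + y) - q * t) (2^-suc-double (i ℕ.+ m)) ⟩
    q * (a + 2^- (i ℕ.+ m)) - q * t
      ≤⟨ ℚ.+-mono-≤ (strong i) (ℚ.neg-antimono-≤ (*-monoʳ (2^-≥0 (suc (i ℕ.+ m))) (Q-antitone i m))) ⟩
    q′ - q′ * t                ≡⟨ solve 2 (λ q t → q :- q :* t := q :* (con 1ℚ :- t)) refl q′ t ⟩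
    q′ * (1ℚ - t)              ∎
    where
    q  = Q m
    q′ = Q (i ℕ.+ m)
    a  = 1ℚ - 2^- m
    t  = 2^- suc (i ℕ.+ m)

-- The distribution of the codimension of a random span

δ : ℕ → ℕ → ℚ
δ i j = 𝟙 (does (i ℕ.≟ j))

δ-diag : ∀ i → δ i i ≡ 1ℚ
δ-diag i = cong 𝟙 (dec-true (i ℕ.≟ i) refl)

δ-≢ : ∀ {i j} → i ≢ j → δ i j ≡ 0ℚ
δ-≢ {i} {j} i≢j = cong 𝟙 (dec-false (i ℕ.≟ j) i≢j)

-- The probability that m uniformly random vectors of 𝔽₂ᵈ span a subspace of
-- codimension j, by conditioning on whether the first vector is zero.
codimProb : ℕ → ℕ → ℕ → ℚ
codimProb j zero    d       = δ j d
codimProb j (suc m) zero    = codimProb j m zero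
codimProb j (suc m) (suc d) =
  2^- suc d * codimProb j m (suc d) + (1ℚ - 2^- suc d) * codimProb j m d

codimProb-d<j : ∀ {j} m {d} → d ℕ.< j → codimProb j m d ≡ 0ℚ
codimProb-d<j zero            d<j = δ-≢ (ℕ.<⇒≢ d<j ∘ sym)
codimProb-d<j (suc m) {zero}  d<j = codimProb-d<j m d<j
codimProb-d<j (suc m) {suc d} d<j
  rewrite codimProb-d<j m d<j | codimProb-d<j m (ℕ.<-trans (ℕ.n<1+n d) d<j) =
  solve 1 (λ t → t :* con 0ℚ :+ (con 1ℚ :- t) :* con 0ℚ := con 0ℚ) refl (2^- suc d)

codimProb-m+j<d : ∀ {j} m {d} → m ℕ.+ j ℕ.< d → codimProb j m d ≡ 0ℚ
codimProb-m+j<d zero            j<d = δ-≢ (ℕ.<⇒≢ j<d)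
codimProb-m+j<d (suc m) {suc d} m+j<d
  rewrite codimProb-m+j<d m (ℕ.<-trans (ℕ.n<1+n _) m+j<d) | codimProb-m+j<d m (ℕ.s<s⁻¹ m+j<d) =
  solve 1 (λ t → t :* con 0ℚ :+ (con 1ℚ :- t) :* con 0ℚ := con 0ℚ) refl (2^- suc d)

-- Codimension j in dimension j is rank zero, so every vector has to vanish.
codimProb-zero-rank : ∀ b j → codimProb j (suc b) j ≡ 2^- j * codimProb j b j
codimProb-zero-rank b zero    = sym (ℚ.*-identityˡ (codimProb 0 b 0))
codimProb-zero-rank b (suc j) rewrite codimProb-d<j b (ℕ.n<1+n j) =
  solve 2 (λ t p → t :* p :+ (con 1ℚ :- t) :* con 0ℚ := t :* p) refl (2^- suc j) (codimProb (suc j) b (suc j))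

-- ρ is the rank and b the number of redundant vectors.  The identity is cleared
-- of denominators.
codimProb-closed : ∀ ρ b j → codimProb j (ρ ℕ.+ b) (ρ ℕ.+ j) * (Q j * (Q b * Q ρ))
                             ≡ 2^- (b ℕ.* j) * (Q (ρ ℕ.+ b) * Q (ρ ℕ.+ j))
codimProb-closed zero zero j rewrite δ-diag j =
  solve 1 (λ q → con 1ℚ :* (q :* (con 1ℚ :* con 1ℚ)) := con 1ℚ :* (con 1ℚ :* q)) refl (Q j)
codimProb-closed zero (suc b) j = begin
  codimProb j (suc b) j * (Q j * (Q b * (1ℚ - v) * 1ℚ))
    ≡⟨ cong (_* (Q j * (Q b * (1ℚ - v) * 1ℚ))) (codimProb-zero-rank b j) ⟩
  (t * p) * (Q j * (Q b * (1ℚ - v) * 1ℚ))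
    ≡⟨ solve 5 (λ t p j b v → (t :* p) :* (j :* (b :* (con 1ℚ :- v) :* con 1ℚ))
         := (t :* (con 1ℚ :- v)) :* (p :* (j :* (b :* con 1ℚ)))) refl t p (Q j) (Q b) v ⟩
  (t * (1ℚ - v)) * (p * (Q j * (Q b * 1ℚ)))
    ≡⟨ cong ((t * (1ℚ - v)) *_) (codimProb-closed zero b j) ⟩
  (t * (1ℚ - v)) * (2^- (b ℕ.* j) * (Q b * Q j))
    ≡⟨ solve 5 (λ t v y b j → (t :* (con 1ℚ :- v)) :* (y :* (b :* j))
         := (t :* y) :* (b :* (con 1ℚ :- v) :* j)) refl t v (2^- (b ℕ.* j)) (Q b) (Q j) ⟩
  (t * 2^- (b ℕ.* j)) * (Q (suc b) * Q j)
    ≡⟨ cong (_* (Q (suc b) * Q j)) (2^-+ j (b ℕ.* j)) ⟨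
  2^- (suc b ℕ.* j) * (Q (suc b) * Q j) ∎
  where
  open ≡-Reasoning
  t = 2^- j
  v = 2^- suc b
  p = codimProb j b j
-- With no redundant vector the first one cannot be zero: the other ρ vectors would have to reach
-- rank ρ + 1.
codimProb-closed (suc ρ) zero j
  rewrite codimProb-m+j<d {j} (ρ ℕ.+ 0) {suc (ρ ℕ.+ j)} (ℕ.≤-reflexive (cong (λ m → suc (m ℕ.+ j)) (ℕ.+-identityʳ ρ)))
        | ℕ.+-identityʳ ρ = begin
  (x * 0ℚ + (1ℚ - x) * p) * (Q j * (1ℚ * (Q ρ * (1ℚ - u))))
    ≡⟨ solve 5 (λ x p j q u → (x :* con 0ℚ :+ (con 1ℚ :- x) :* p) :* (j :* (con 1ℚ :* (q :* (con 1ℚ :- u))))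
         := ((con 1ℚ :- x) :* (con 1ℚ :- u)) :* (p :* (j :* (con 1ℚ :* q)))) refl x p (Q j) (Q ρ) u ⟩
  ((1ℚ - x) * (1ℚ - u)) * (p * (Q j * (1ℚ * Q ρ)))
    ≡⟨ cong (((1ℚ - x) * (1ℚ - u)) *_)
         (subst (λ m → codimProb j m (ρ ℕ.+ j) * (Q j * (1ℚ * Q ρ)) ≡ 1ℚ * (Q m * Q (ρ ℕ.+ j)))
           (ℕ.+-identityʳ ρ) (codimProb-closed ρ zero j)) ⟩
  ((1ℚ - x) * (1ℚ - u)) * (1ℚ * (Q ρ * Q (ρ ℕ.+ j)))
    ≡⟨ solve 4 (λ x u a b → ((con 1ℚ :- x) :* (con 1ℚ :- u)) :* (con 1ℚ :* (a :* b))
         := con 1ℚ :* ((a :* (con 1ℚ :- u)) :* (b :* (con 1ℚ :- x)))) refl x u (Q ρ) (Q (ρ ℕ.+ j)) ⟩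
  1ℚ * (Q (suc ρ) * Q (suc ρ ℕ.+ j)) ∎
  where
  open ≡-Reasoning
  x = 2^- suc (ρ ℕ.+ j)
  u = 2^- suc ρ
  p = codimProb j ρ (ρ ℕ.+ j)
codimProb-closed (suc ρ) (suc b) j = begin
  (x * codimProb j (ρ ℕ.+ suc b) (suc ρ ℕ.+ j) + (1ℚ - x) * p₂) * (Q j * (Q b * (1ℚ - v) * (Q ρ * (1ℚ - u))))
    ≡⟨ cong (λ m → (x * codimProb j m (suc ρ ℕ.+ j) + (1ℚ - x) * p₂) * (Q j * (Q b * (1ℚ - v) * (Q ρ * (1ℚ - u)))))
            (ℕ.+-suc ρ b) ⟩
  (x * p₁ + (1ℚ - x) * p₂) * (Q j * (Q b * (1ℚ - v) * (Q ρ * (1ℚ - u))))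
    ≡⟨ solve 8 (λ x p₁ p₂ j b v r u →
         (x :* p₁ :+ (con 1ℚ :- x) :* p₂) :* (j :* (b :* (con 1ℚ :- v) :* (r :* (con 1ℚ :- u))))
         := (x :* (con 1ℚ :- v)) :* (p₁ :* (j :* (b :* (r :* (con 1ℚ :- u)))))
            :+ ((con 1ℚ :- x) :* (con 1ℚ :- u)) :* (p₂ :* (j :* (b :* (con 1ℚ :- v) :* r))))
         refl x p₁ p₂ (Q j) (Q b) v (Q ρ) u ⟩
  (x * (1ℚ - v)) * (p₁ * (Q j * (Q b * Q (suc ρ)))) + ((1ℚ - x) * (1ℚ - u)) * (p₂ * (Q j * (Q (suc b) * Q ρ)))
    ≡⟨ cong₂ (λ a b → (x * (1ℚ - v)) * a + ((1ℚ - x) * (1ℚ - u)) * b)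
         (codimProb-closed (suc ρ) b j) (codimProb-closed ρ (suc b) j) ⟩
  (x * (1ℚ - v)) * (y * (Q (suc ρ ℕ.+ b) * (z * (1ℚ - x))))
    + ((1ℚ - x) * (1ℚ - u)) * (2^- (suc b ℕ.* j) * (q * z))
    ≡⟨ cong₂ (λ m w → (x * (1ℚ - v)) * (y * (Q m * (z * (1ℚ - x)))) + ((1ℚ - x) * (1ℚ - u)) * (w * (q * z)))
         (sym (ℕ.+-suc ρ b)) (2^-+ j (b ℕ.* j)) ⟩
  (x * (1ℚ - v)) * (y * (q * (z * (1ℚ - x)))) + ((1ℚ - x) * (1ℚ - u)) * ((t * y) * (q * z))
    ≡⟨ cong (λ w → (w * (1ℚ - v)) * (y * (q * (z * (1ℚ - x)))) + ((1ℚ - x) * (1ℚ - u)) * ((t * y) * (q * z)))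
         (2^-+ (suc ρ) j) ⟩
  ((u * t) * (1ℚ - v)) * (y * (q * (z * (1ℚ - x)))) + ((1ℚ - x) * (1ℚ - u)) * ((t * y) * (q * z))
    -- Both terms share the factor t y q z (1 - x), and u(1 - v) + (1 - u) = 1 - uv: the q-Pascal
    -- rule at q = 1/2.
    ≡⟨ solve 7 (λ u t v y q z x →
         ((u :* t) :* (con 1ℚ :- v)) :* (y :* (q :* (z :* (con 1ℚ :- x))))
         :+ ((con 1ℚ :- x) :* (con 1ℚ :- u)) :* ((t :* y) :* (q :* z))
         := (t :* y) :* ((q :* (con 1ℚ :- u :* v)) :* (z :* (con 1ℚ :- x))))
         refl u t v y q z x ⟩
  (t * y) * ((q * (1ℚ - u * v)) * (z * (1ℚ - x)))
    ≡⟨ cong₂ (λ w s → w * ((q * (1ℚ - s)) * (z * (1ℚ - x)))) (2^-+ j (b ℕ.* j)) (2^-+ (suc ρ) (suc b)) ⟨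
  2^- (suc b ℕ.* j) * (Q (suc ρ ℕ.+ suc b) * Q (suc ρ ℕ.+ j)) ∎
  where
  open ≡-Reasoning
  x  = 2^- suc (ρ ℕ.+ j)
  u  = 2^- suc ρ
  v  = 2^- suc b
  t  = 2^- j
  y  = 2^- (b ℕ.* j)
  q  = Q (ρ ℕ.+ suc b)
  z  = Q (ρ ℕ.+ j)
  p₁ = codimProb j (suc ρ ℕ.+ b) (suc ρ ℕ.+ j)
  p₂ = codimProb j (ρ ℕ.+ suc b) (ρ ℕ.+ j)

Σ₁-δ-zero : ∀ J d (a : ℕ → ℚ) → J ℕ.< d → Σ₁ J (λ j → δ j d * a j) ≡ 0ℚ
Σ₁-δ-zero zero    d a J<d = refl
Σ₁-δ-zero (suc J) d a J<d
  rewrite Σ₁-δ-zero J d a (ℕ.<-trans (ℕ.n<1+n J) J<d) | δ-≢ (ℕ.<⇒≢ J<d) =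
  solve 1 (λ a → con 0ℚ :+ con 0ℚ :* a := con 0ℚ) refl (a (suc J))

Σ₁-δ-≤ : ∀ J d (a : ℕ → ℚ) → 0ℚ ≤ a d → Σ₁ J (λ j → δ j d * a j) ≤ a d
Σ₁-δ-≤ zero    d a a≥0 = a≥0
Σ₁-δ-≤ (suc J) d a a≥0 with suc J ℕ.≟ d
... | yes refl  = ℚ.≤-reflexive (trans
        (cong₂ (λ y z → y + z * a (suc J)) (Σ₁-δ-zero J (suc J) a (ℕ.n<1+n J)) (δ-diag (suc J)))
        (solve 1 (λ a → con 0ℚ :+ con 1ℚ :* a := a) refl (a (suc J))))
... | no  1+J≢d = subst (_≤ a d) (trans
        (solve 2 (λ s a → s := s :+ con 0ℚ :* a) refl (Σ₁ J (λ j → δ j d * a j)) (a (suc J)))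
        (cong (λ z → Σ₁ J (λ j → δ j d * a j) + z * a (suc J)) (sym (δ-≢ 1+J≢d))))
        (Σ₁-δ-≤ J d a a≥0)

Σ₁-mix : ∀ J s r (f g a : ℕ → ℚ) →
         Σ₁ J (λ j → (s * f j + r * g j) * a j) ≡ s * Σ₁ J (λ j → f j * a j) + r * Σ₁ J (λ j → g j * a j)
Σ₁-mix zero    s r f g a = solve 2 (λ s r → con 0ℚ := s :* con 0ℚ :+ r :* con 0ℚ) refl s r
Σ₁-mix (suc J) s r f g a rewrite Σ₁-mix J s r f g a =
  solve 7 (λ s r F G f g a → (s :* F :+ r :* G) :+ (s :* f :+ r :* g) :* a
    := s :* (F :+ f :* a) :+ r :* (G :+ g :* a)) refl
    s r (Σ₁ J (λ j → f j * a j)) (Σ₁ J (λ j → g j * a j)) (f (suc J)) (g (suc J)) (a (suc J))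

Σ₁-lower : ∀ J q e (s f : ℕ → ℚ) → (∀ {i} → i ℕ.< J → q * s (suc i) - e ≤ f (suc i)) →
           q * Σ₁ J s - ι J * e ≤ Σ₁ J f
Σ₁-lower zero    q e s f le = ℚ.≤-reflexive (solve 2 (λ q e → q :* con 0ℚ :- con 0ℚ :* e := con 0ℚ) refl q e)
Σ₁-lower (suc J) q e s f le = begin
  q * (Σ₁ J s + s (suc J)) - ι (suc J) * e
    ≡⟨ cong (λ y → q * (Σ₁ J s + s (suc J)) - y * e) (ι-+ 1 J) ⟩
  q * (Σ₁ J s + s (suc J)) - (1ℚ + ι J) * e
    ≡⟨ solve 5 (λ q S s l e → q :* (S :+ s) :- (con 1ℚ :+ l) :* e := (q :* S :- l :* e) :+ (q :* s :- e))
         refl q (Σ₁ J s) (s (suc J)) (ι J) e ⟩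
  (q * Σ₁ J s - ι J * e) + (q * s (suc J) - e)
    ≤⟨ ℚ.+-mono-≤ (Σ₁-lower J q e s f (le ∘ ℕ.m<n⇒m<1+n)) (le (ℕ.n<1+n J)) ⟩
  Σ₁ J f + f (suc J) ∎
  where open ℚ.≤-Reasoning

-- `codimProb j m d` is also the chance that the chain moves from density 2^-d to 2^-j in m steps,
-- since both obey the same one-step recursion. The sum leaves out j = 0 and every j > J, hence the
-- inequality for nonnegative values of `φ`.
evolve-expansion : ∀ J m d φ → (∀ j → 0ℚ ≤ φ (2^- j)) →
                   Σ₁ J (λ j → codimProb j m d * φ (2^- j)) ≤ evolve m φ (2^- d)
evolve-expansion J zero    d       φ φ≥0 = Σ₁-δ-≤ J d (φ ∘ 2^-_) (φ≥0 d)
evolve-expansion J (suc m) zero    φ φ≥0 = subst (Σ₁ J (λ j → codimProb j m 0 * φ (2^- j)) ≤_)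
  (solve 2 (λ a b → a := con 1ℚ :* a :+ (con 1ℚ :- con 1ℚ) :* b) refl (evolve m φ 1ℚ) (evolve m φ (1ℚ + 1ℚ)))
  (evolve-expansion J m zero φ φ≥0)
evolve-expansion J (suc m) (suc d) φ φ≥0 = begin
  Σ₁ J (λ j → (t * codimProb j m (suc d) + (1ℚ - t) * codimProb j m d) * φ (2^- j))
    ≡⟨ Σ₁-mix J t (1ℚ - t) (λ j → codimProb j m (suc d)) (λ j → codimProb j m d) (φ ∘ 2^-_) ⟩
  t * Σ₁ J (λ j → codimProb j m (suc d) * φ (2^- j)) + (1ℚ - t) * Σ₁ J (λ j → codimProb j m d * φ (2^- j))
    ≤⟨ ℚ.+-mono-≤ (*-monoˡ (2^-≥0 (suc d)) (evolve-expansion J m (suc d) φ φ≥0))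
                  (*-monoˡ (p≤q⇒0≤q-p (2^-≤1 (suc d))) (evolve-expansion J m d φ φ≥0)) ⟩
  t * evolve m φ t + (1ℚ - t) * evolve m φ (2^- d)
    ≡⟨ cong (λ y → t * evolve m φ t + (1ℚ - t) * evolve m φ y) (2^-suc-double d) ⟨
  evolve (suc m) φ t ∎
  where
  open ℚ.≤-Reasoning
  t = 2^- suc d

-- Matching the codimension distribution with the series

tri : ℕ → ℚ
tri i = Π₁ i 2^-_

-- `tri i` is 2 to the power -i(i+1)/2; squaring removes the half from the exponent.
tri² : ∀ i → tri i * tri i ≡ 2^- (i ℕ.* suc i)
tri² zero    = refl
tri² (suc i) = begin
  (tri i * t) * (tri i * t)                     ≡⟨ solve 2 (λ a t → (a :* t) :* (a :* t) := (t :* t) :* (a :* a)) refl (tri i) t ⟩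
  (t * t) * (tri i * tri i)                     ≡⟨ cong₂ _*_ (sym (2^-+ (suc i) (suc i))) (tri² i) ⟩
  2^- (suc i ℕ.+ suc i) * 2^- (i ℕ.* suc i)     ≡⟨ 2^-+ (suc i ℕ.+ suc i) (i ℕ.* suc i) ⟨
  2^- (suc i ℕ.+ suc i ℕ.+ i ℕ.* suc i)         ≡⟨ cong 2^-_ (ℕSolver.solve 1 (λ i →
      (con′ 1 +′ i) +′ (con′ 1 +′ i) +′ i *′ (con′ 1 +′ i) =′ (con′ 1 +′ i) *′ (con′ 2 +′ i)) refl i) ⟩
  2^- (suc i ℕ.* suc (suc i))                   ∎
  where
  open ≡-Reasoning
  t = 2^- suc i

2^-*ι : ∀ i → 2^- i * ι (2 ℕ.^ i) ≡ 1ℚ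
2^-*ι i = recip-ι (2 ℕ.^ i) {{ℕ.m^n≢0 2 i}}

-- Each factor 1 - 2^-l of `Q i` is (2^l - 1) 2^-l.
Q≡ιD*tri : ∀ i → Q i ≡ ι (D i) * tri i
Q≡ιD*tri zero    = refl
Q≡ιD*tri (suc i) = begin
  Q i * (1ℚ - t)                          ≡⟨ cong₂ _*_ (Q≡ιD*tri i) factor ⟩
  (ι (D i) * tri i) * (ι M * t)           ≡⟨ solve 4 (λ a b c d → (a :* b) :* (c :* d) := (a :* c) :* (b :* d)) refl (ι (D i)) (tri i) (ι M) t ⟩
  (ι (D i) * ι M) * (tri i * t)           ≡⟨ cong (_* (tri i * t)) (ι-* (D i) M) ⟨
  ι (D (suc i)) * tri (suc i)             ∎
  where
  open ≡-Reasoning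
  t = 2^- suc i
  M = 2 ℕ.^ suc i ℕ.∸ 1
  factor : 1ℚ - t ≡ ι M * t
  factor = begin
    1ℚ - t                                ≡⟨ cong (λ y → y - t) (2^-*ι (suc i)) ⟨
    t * ι (2 ℕ.^ suc i) - t               ≡⟨ cong (λ m → t * ι m - t) (ℕ.m+[n∸m]≡n (ℕ.m^n>0 2 (suc i))) ⟨
    t * ι (1 ℕ.+ M) - t                   ≡⟨ cong (λ y → t * y - t) (ι-+ 1 M) ⟩
    t * (1ℚ + ι M) - t                    ≡⟨ solve 2 (λ t m → t :* (con 1ℚ :+ m) :- t := m :* t) refl t (ι M) ⟩
    ι M * t                               ∎

1/D² : ℕ → ℚ
1/D² i = recip (D i ℕ.^ 2) {{D²-nonZero i}}

-- The power of 2 on the right is exactly the one in `codimProb-closed` for i redundant vectors and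
-- codimension i + 1, so it disappears when the probability is written with `D`.
1/D²*Q² : ∀ i → 1/D² i * (Q i * Q i) ≡ 2^- (i ℕ.* suc i)
1/D²*Q² i = begin
  r * (Q i * Q i)                            ≡⟨ cong (λ q → r * (q * q)) (Q≡ιD*tri i) ⟩
  r * ((ι (D i) * tri i) * (ι (D i) * tri i)) ≡⟨ solve 3 (λ r d t → r :* ((d :* t) :* (d :* t)) := (r :* (d :* (d :* con 1ℚ))) :* (t :* t)) refl r (ι (D i)) (tri i) ⟩
  (r * (ι (D i) * (ι (D i) * 1ℚ))) * (tri i * tri i)
    ≡⟨ cong₂ (λ a b → (r * a) * b) (trans (cong (ι (D i) *_) (sym (ι-* (D i) 1))) (sym (ι-* (D i) (D i ℕ.* 1)))) (tri² i) ⟩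
  (r * ι (D i ℕ.^ 2)) * 2^- (i ℕ.* suc i)    ≡⟨ cong (_* 2^- (i ℕ.* suc i)) (recip-ι (D i ℕ.^ 2) {{D²-nonZero i}}) ⟩
  1ℚ * 2^- (i ℕ.* suc i)                     ≡⟨ ℚ.*-identityˡ _ ⟩
  2^- (i ℕ.* suc i)                          ∎
  where
  open ≡-Reasoning
  r = 1/D² i

1/D²≥0 : ∀ i → 0ℚ ≤ 1/D² i
1/D²≥0 i = ℚ.<⇒≤ (recip>0 (D i ℕ.^ 2) {{D²-nonZero i}})

1/D²≤1 : ∀ i → 1/D² i ≤ 1ℚ
1/D²≤1 i = begin
  1/D² i                     ≡⟨ ℚ.*-identityʳ (1/D² i) ⟨
  1/D² i * 1ℚ                ≤⟨ *-monoˡ (1/D²≥0 i) (ι-mono (ℕ.>-nonZero⁻¹ (D i ℕ.^ 2) {{D²-nonZero i}})) ⟩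
  1/D² i * ι (D i ℕ.^ 2)     ≡⟨ recip-ι (D i ℕ.^ 2) {{D²-nonZero i}} ⟩
  1ℚ                         ∎
  where open ℚ.≤-Reasoning

summand≥0 : ∀ i → 0ℚ ≤ summand (suc i)
summand≥0 i = *-≥0 (2^-≥0 (suc i)) (1/D²≥0 i)

-- The increment of the density of the span is x(1 − x) on average.
increment : ℚ → ℚ
increment x = x * (1ℚ - x)

increment≥0 : ∀ j → 0ℚ ≤ increment (2^- j)
increment≥0 j = *-≥0 (2^-≥0 j) (p≤q⇒0≤q-p (2^-≤1 j))

-- The right-hand side equals `Q k * summand (suc i)` times the ratio `Q (suc k)` / `Q ρ`, which is
-- at least 1 - 2^-ρ by `Q-tail`. Since `summand (suc i)` is at most 2^-(i+1), the loss is at most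
-- 2^-(i+1) 2^-ρ = 2^-(k+1), uniformly in i.
codimProb-increment : ∀ ρ i → let k = ρ ℕ.+ i in
  Q k * summand (suc i) - 2^- suc k ≤ codimProb (suc i) k (suc k) * increment (2^- suc i)
codimProb-increment ρ i = begin
  Q k * s - 2^- suc k                ≡⟨ cong (λ m → Q k * s - 2^- m) (cong suc (ℕ.+-comm ρ i)) ⟩
  Q k * s - 2^- (suc i ℕ.+ ρ)        ≡⟨ cong (λ y → Q k * s - y) (2^-+ (suc i) ρ) ⟩
  Q k * s - t * e                    ≤⟨ ℚ.+-monoʳ-≤ (Q k * s) (ℚ.neg-antimono-≤ (*-monoʳ (2^-≥0 ρ) Qs≤t)) ⟩
  Q k * s - (Q k * s) * e            ≡⟨ solve 2 (λ q e → q :- q :* e := q :* (con 1ℚ :- e)) refl (Q k * s) e ⟩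
  (Q k * s) * (1ℚ - e)               ≤⟨ ℚ.*-cancelʳ-≤-pos W {{ℚ.positive W>0}} scaled ⟩
  p * (t * (1ℚ - t))                 ∎
  where
  open ℚ.≤-Reasoning
  k = ρ ℕ.+ i
  s = summand (suc i)
  t = 2^- suc i
  e = 2^- ρ
  r = 1/D² i
  p = codimProb (suc i) k (suc k)
  W = Q ρ * (Q i * Q i)
  W>0 : 0ℚ < W
  W>0 = *->0 (Q>0 ρ) (*->0 (Q>0 i) (Q>0 i))
  Qs≤t : Q k * s ≤ t
  Qs≤t = begin
    Q k * (t * r)    ≤⟨ *-monoʳ (summand≥0 i) (Q≤1 k) ⟩
    1ℚ * (t * r)     ≡⟨ ℚ.*-identityˡ (t * r) ⟩
    t * r            ≤⟨ *-monoˡ (2^-≥0 (suc i)) (1/D²≤1 i) ⟩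
    t * 1ℚ           ≡⟨ ℚ.*-identityʳ t ⟩
    t                ∎
  closed : p * (Q (suc i) * (Q i * Q ρ)) ≡ 2^- (i ℕ.* suc i) * (Q k * Q (suc k))
  closed = subst (λ d → codimProb (suc i) k d * (Q (suc i) * (Q i * Q ρ)) ≡ 2^- (i ℕ.* suc i) * (Q k * Q d))
    (ℕ.+-suc ρ i) (codimProb-closed ρ i (suc i))
  scaled : ((Q k * s) * (1ℚ - e)) * W ≤ (p * (t * (1ℚ - t))) * W
  scaled = begin
    ((Q k * s) * (1ℚ - e)) * (Q ρ * (Q i * Q i))
      ≡⟨ solve 5 (λ k s e ρ i → ((k :* s) :* (con 1ℚ :- e)) :* (ρ :* (i :* i))
           := ((k :* s) :* (i :* i)) :* (ρ :* (con 1ℚ :- e))) refl (Q k) s e (Q ρ) (Q i) ⟩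
    ((Q k * s) * (Q i * Q i)) * (Q ρ * (1ℚ - e))
      ≤⟨ *-monoˡ (*-≥0 (*-≥0 (Q≥0 k) (summand≥0 i)) (*-≥0 (Q≥0 i) (Q≥0 i)))
           (subst (λ m → Q ρ * (1ℚ - e) ≤ Q (suc m)) (ℕ.+-comm i ρ) (Q-tail (suc i) ρ)) ⟩
    ((Q k * (t * r)) * (Q i * Q i)) * Q (suc k)
      ≡⟨ solve 5 (λ k t r i k′ → ((k :* (t :* r)) :* (i :* i)) :* k′ := t :* ((r :* (i :* i)) :* (k :* k′)))
           refl (Q k) t r (Q i) (Q (suc k)) ⟩
    t * ((r * (Q i * Q i)) * (Q k * Q (suc k)))
      ≡⟨ cong (λ y → t * (y * (Q k * Q (suc k)))) (1/D²*Q² i) ⟩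
    t * (2^- (i ℕ.* suc i) * (Q k * Q (suc k)))
      ≡⟨ cong (t *_) closed ⟨
    t * (p * (Q i * (1ℚ - t) * (Q i * Q ρ)))
      -- The factor 1 - t of `Q (suc i)` is absorbed by the increment, which leaves the square of
      -- `Q i` and so accounts for the square in the series.
      ≡⟨ solve 4 (λ t p i ρ → t :* (p :* (i :* (con 1ℚ :- t) :* (i :* ρ)))
           := (p :* (t :* (con 1ℚ :- t))) :* (ρ :* (i :* i))) refl t p (Q i) (Q ρ) ⟩
    (p * (t * (1ℚ - t))) * (Q ρ * (Q i * Q i)) ∎

-- Lower bound for the average gain

1+n≤2^n : ∀ n → suc n ℕ.≤ 2 ℕ.^ n
1+n≤2^n zero    = ℕ.≤-refl
1+n≤2^n (suc n) = begin
  1 ℕ.+ suc n                  ≤⟨ ℕ.+-mono-≤ (ℕ.m^n>0 2 n) (1+n≤2^n n) ⟩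
  2 ℕ.^ n ℕ.+ 2 ℕ.^ n          ≡⟨ cong (2 ℕ.^ n ℕ.+_) (ℕ.+-identityʳ (2 ℕ.^ n)) ⟨
  2 ℕ.^ suc n                  ∎
  where open ℕ.≤-Reasoning

k[1+k]≤2^[1+k] : ∀ k → k ℕ.* suc k ℕ.≤ 2 ℕ.^ suc k
k[1+k]≤2^[1+k] zero    = z≤n
k[1+k]≤2^[1+k] (suc k) = begin
  suc k ℕ.* suc (suc k)                  ≡⟨ ℕSolver.solve 1 (λ k → (con′ 1 +′ k) *′ (con′ 2 +′ k)
       =′ k *′ (con′ 1 +′ k) +′ con′ 2 *′ (con′ 1 +′ k)) refl k ⟩
  k ℕ.* suc k ℕ.+ 2 ℕ.* suc k            ≤⟨ ℕ.+-mono-≤ (k[1+k]≤2^[1+k] k) (ℕ.*-monoʳ-≤ 2 (1+n≤2^n k)) ⟩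
  2 ℕ.^ suc k ℕ.+ 2 ℕ.^ suc k            ≡⟨ cong (2 ℕ.^ suc k ℕ.+_) (ℕ.+-identityʳ (2 ℕ.^ suc k)) ⟨
  2 ℕ.^ suc (suc k)                      ∎
  where
  open ℕ.≤-Reasoning

ι≥0 : ∀ k → 0ℚ ≤ ι k
ι≥0 k = ι-mono {0} {k} z≤n

-- Weakens an exponentially small loss to the size of the loss in `next-level`, so that a single
-- kind of error term remains.
ι*2^-≤recip : ∀ k → ι k * 2^- suc k ≤ recip (suc k)
ι*2^-≤recip k = begin
  ι k * t                                 ≡⟨ ℚ.*-identityʳ (ι k * t) ⟨
  (ι k * t) * 1ℚ                          ≡⟨ cong ((ι k * t) *_) (recip-ι (suc k)) ⟨
  (ι k * t) * (r * ι (suc k))             ≡⟨ solve 4 (λ k t r k′ → (k :* t) :* (r :* k′) := (r :* t) :* (k :* k′)) refl (ι k) t r (ι (suc k)) ⟩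
  (r * t) * (ι k * ι (suc k))             ≡⟨ cong ((r * t) *_) (ι-* k (suc k)) ⟨
  (r * t) * ι (k ℕ.* suc k)               ≤⟨ *-monoˡ (*-≥0 (ℚ.<⇒≤ (recip>0 (suc k))) (2^-≥0 (suc k))) (ι-mono (k[1+k]≤2^[1+k] k)) ⟩
  (r * t) * ι (2 ℕ.^ suc k)               ≡⟨ ℚ.*-assoc r t _ ⟩
  r * (t * ι (2 ℕ.^ suc k))               ≡⟨ cong (r *_) (2^-*ι (suc k)) ⟩
  r * 1ℚ                                  ≡⟨ ℚ.*-identityʳ r ⟩
  r                                       ∎
  where
  open ℚ.≤-Reasoning
  t = 2^- suc k
  r = recip (suc k)

-- Cutting the series after k terms keeps the rank ρ = k - i a natural number in every term; the k
-- losses of 2^-(k+1) are then added up.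
gain : ∀ k → Q k * Σ₁ k summand - recip (suc k) ≤ evolve k increment (2^- suc k)
gain k = begin
  Q k * Σ₁ k summand - recip (suc k)
    ≤⟨ ℚ.+-monoʳ-≤ (Q k * Σ₁ k summand) (ℚ.neg-antimono-≤ (ι*2^-≤recip k)) ⟩
  Q k * Σ₁ k summand - ι k * 2^- suc k
    ≤⟨ Σ₁-lower k (Q k) (2^- suc k) summand (λ j → codimProb j k (suc k) * increment (2^- j)) term ⟩
  Σ₁ k (λ j → codimProb j k (suc k) * increment (2^- j))
    ≤⟨ evolve-expansion k k (suc k) increment increment≥0 ⟩
  evolve k increment (2^- suc k) ∎
  where
  open ℚ.≤-Reasoning
  term : ∀ {i} → i ℕ.< k →
         Q k * summand (suc i) - 2^- suc k ≤ codimProb (suc i) k (suc k) * increment (2^- suc i)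
  term {i} i<k = subst (λ k → Q k * summand (suc i) - 2^- suc k ≤ codimProb (suc i) k (suc k) * increment (2^- suc i))
    (ℕ.m∸n+n≡m (ℕ.<⇒≤ i<k)) (codimProb-increment (k ℕ.∸ i) i)

-- Taking the extra vector as the last step of the chain, `step id x` is x plus `increment x`.
spanProb-suc : ∀ d k → spanProb d (suc k) ≡ spanProb d k + evolve k increment (2^- d)
spanProb-suc d k = begin
  evolve (suc k) id x                      ≡⟨ evolve-step k id x ⟨
  evolve k (step id) x                     ≡⟨ evolve-cong k (solve 1 (λ x →
      x :* x :+ (con 1ℚ :- x) :* (x :+ x) := x :+ x :* (con 1ℚ :- x)) refl) x ⟩
  evolve k (λ x → x + increment x) x       ≡⟨ evolve-+ k id increment x ⟩
  evolve k id x + evolve k increment x     ∎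
  where
  open ≡-Reasoning
  x = 2^- d

-- Read off from the realisation as the probability that all m vectors (`⊤`) span `w`; the recursion
-- of `evolve` runs over all rationals, where such bounds fail in general.
spanProb≥0 : ∀ d m → 0ℚ ≤ spanProb d m
spanProb≥0 d m = subst₂ _≤_ (𝔼-const M 0ℚ) (trans (𝔼-spans m d ⊤) (cong (spanProb d) (Subset.∣⊤∣≡n m)))
  (𝔼-mono M λ _ → 𝟙≥0 _)
  where
  M = 𝔼config m d
  𝟙≥0 : ∀ b → 0ℚ ≤ 𝟙 b
  𝟙≥0 true  = ℚ.nonNegative⁻¹ 1ℚ
  𝟙≥0 false = ℚ.≤-refl

spanProb≤1 : ∀ d m → spanProb d m ≤ 1ℚ
spanProb≤1 d m = subst₂ _≤_ (trans (𝔼-spans m d ⊤) (cong (spanProb d) (Subset.∣⊤∣≡n m))) (𝔼-const M 1ℚ)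
  (𝔼-mono M λ _ → 𝟙≤1 _)
  where
  M = 𝔼config m d
  𝟙≤1 : ∀ b → 𝟙 b ≤ 1ℚ
  𝟙≤1 true  = ℚ.≤-refl
  𝟙≤1 false = ℚ.nonNegative⁻¹ 1ℚ

-- Asymptotics

-- The ratio rule (k+1) C(n,k+1) = (n-k) C(n,k) with the subtraction moved across, so that it holds
-- for k > n too and follows by induction from Pascal's rule.
absorption : ∀ n k → suc k ℕ.* (n C suc k) ℕ.+ k ℕ.* (n C k) ≡ n ℕ.* (n C k)
absorption zero    zero    = refl
absorption zero    (suc k) = cong₂ ℕ._+_ (ℕ.*-zeroʳ (suc (suc k))) (ℕ.*-zeroʳ (suc k))
absorption (suc n) zero    rewrite nC1≡n (suc n) =
  ℕSolver.solve 1 (λ n → con′ 1 *′ (con′ 1 +′ n) +′ con′ 0 =′ (con′ 1 +′ n) *′ con′ 1) refl n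
absorption (suc n) (suc k) = begin
  suc (suc k) ℕ.* (suc n C suc (suc k)) ℕ.+ suc k ℕ.* (suc n C suc k)
    ≡⟨ cong₂ (λ x y → suc (suc k) ℕ.* x ℕ.+ suc k ℕ.* y)
         (nCk+nC[k+1]≡[n+1]C[k+1] n (suc k)) (nCk+nC[k+1]≡[n+1]C[k+1] n k) ⟨
  suc (suc k) ℕ.* (n C suc k ℕ.+ n C suc (suc k)) ℕ.+ suc k ℕ.* (n C k ℕ.+ n C suc k)
    ≡⟨ ℕSolver.solve 4 (λ k a b e →
         (con′ 2 +′ k) *′ (b +′ e) +′ (con′ 1 +′ k) *′ (a +′ b)
         =′ ((con′ 2 +′ k) *′ e +′ (con′ 1 +′ k) *′ b) +′ ((con′ 1 +′ k) *′ b +′ k *′ a) +′ (a +′ b))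
         refl k (n C k) (n C suc k) (n C suc (suc k)) ⟩
  (suc (suc k) ℕ.* (n C suc (suc k)) ℕ.+ suc k ℕ.* (n C suc k))
    ℕ.+ (suc k ℕ.* (n C suc k) ℕ.+ k ℕ.* (n C k)) ℕ.+ (n C k ℕ.+ n C suc k)
    ≡⟨ cong₂ (λ x y → x ℕ.+ y ℕ.+ (n C k ℕ.+ n C suc k)) (absorption n (suc k)) (absorption n k) ⟩
  n ℕ.* (n C suc k) ℕ.+ n ℕ.* (n C k) ℕ.+ (n C k ℕ.+ n C suc k)
    ≡⟨ ℕSolver.solve 3 (λ n a b → n *′ b +′ n *′ a +′ (a +′ b) =′ (con′ 1 +′ n) *′ (a +′ b))
         refl n (n C k) (n C suc k) ⟩
  suc n ℕ.* (n C k ℕ.+ n C suc k)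
    ≡⟨ cong (suc n ℕ.*_) (nCk+nC[k+1]≡[n+1]C[k+1] n k) ⟩
  suc n ℕ.* (suc n C suc k) ∎
  where
  open ≡-Reasoning

-- The ratio of the two binomials is (n-k)/(k+1), at least k/(k+1) when 2k is at most n.
next-level : ∀ n k → k ℕ.+ k ℕ.≤ n → ι (n C k) * (1ℚ - recip (suc k)) ≤ ι (n C suc k)
next-level n k 2k≤n = begin
  ι a * (1ℚ - r)                          ≡⟨ cong (λ y → ι a * (y - r)) (recip-ι (suc k)) ⟨
  ι a * (r * ι (suc k) - r)               ≡⟨ cong (λ y → ι a * (r * y - r)) (ι-+ 1 k) ⟩
  ι a * (r * (1ℚ + ι k) - r)              ≡⟨ solve 3 (λ a r k → a :* (r :* (con 1ℚ :+ k) :- r) := r :* (k :* a)) refl (ι a) r (ι k) ⟩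
  r * (ι k * ι a)                         ≡⟨ cong (r *_) (ι-* k a) ⟨
  r * ι (k ℕ.* a)                         ≤⟨ *-monoˡ (ℚ.<⇒≤ (recip>0 (suc k))) (ι-mono ka≤) ⟩
  r * ι (suc k ℕ.* b)                     ≡⟨ cong (r *_) (ι-* (suc k) b) ⟩
  r * (ι (suc k) * ι b)                   ≡⟨ ℚ.*-assoc r (ι (suc k)) (ι b) ⟨
  (r * ι (suc k)) * ι b                   ≡⟨ cong (_* ι b) (recip-ι (suc k)) ⟩
  1ℚ * ι b                                ≡⟨ ℚ.*-identityˡ (ι b) ⟩
  ι b                                     ∎
  where
  a = n C k
  b = n C suc k
  r = recip (suc k)
  ka≤ : k ℕ.* a ℕ.≤ suc k ℕ.* b
  ka≤ = ℕ.+-cancelʳ-≤ (k ℕ.* a) _ _ (begin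
    k ℕ.* a ℕ.+ k ℕ.* a            ≡⟨ ℕ.*-distribʳ-+ a k k ⟨
    (k ℕ.+ k) ℕ.* a                ≤⟨ ℕ.*-monoˡ-≤ a 2k≤n ⟩
    n ℕ.* a                        ≡⟨ absorption n k ⟨
    suc k ℕ.* b ℕ.+ k ℕ.* a        ∎)
    where open ℕ.≤-Reasoning
  open ℚ.≤-Reasoning

-- One `recip (suc k)` is the loss in `gain`; the other is the loss in `next-level`, weighted by a
-- probability that is at most 1.
La-bound : ∀ n k → k ℕ.+ k ℕ.≤ n →
           (1ℚ + (Q k * Σ₁ k summand - (recip (suc k) + recip (suc k)))) * ι (n C k) ≤ ι (La n O₆)
La-bound n k 2k≤n = begin
  (1ℚ + (s - (r + r))) * a             ≡⟨ solve 3 (λ s r a → (con 1ℚ :+ (s :- (r :+ r))) :* a := a :* ((con 1ℚ :+ (s :- r)) :- con 1ℚ :* r)) refl s r a ⟩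
  a * ((1ℚ + (s - r)) - 1ℚ * r)        ≤⟨ *-monoˡ (ι≥0 (n C k)) (ℚ.+-mono-≤ (ℚ.+-monoʳ-≤ 1ℚ (gain k))
                                            (ℚ.neg-antimono-≤ (*-monoʳ (ℚ.<⇒≤ (recip>0 (suc k))) (spanProb≤1 (suc k) (suc k))))) ⟩
  a * ((1ℚ + g) - p′ * r)              ≡⟨ solve 5 (λ a p g p′ r → a :* ((con 1ℚ :+ g) :- p′ :* r) := a :* (con 1ℚ :- p) :+ a :* ((p :+ g) :- p′ :* r)) refl a p g p′ r ⟩
  a * (1ℚ - p) + a * ((p + g) - p′ * r) ≡⟨ cong (λ y → a * (1ℚ - p) + a * (y - p′ * r)) (spanProb-suc (suc k) k) ⟨
  a * (1ℚ - p) + a * (p′ - p′ * r)     ≡⟨ cong (λ y → a * (1ℚ - p) + y) (solve 3 (λ a p r → a :* (p :- p :* r) := (a :* (con 1ℚ :- r)) :* p) refl a p′ r) ⟩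
  a * (1ℚ - p) + (a * (1ℚ - r)) * p′   ≤⟨ ℚ.+-monoʳ-≤ (a * (1ℚ - p)) (*-monoʳ (spanProb≥0 (suc k) (suc k)) (next-level n k 2k≤n)) ⟩
  a * (1ℚ - p) + ι (n C suc k) * p′    ≤⟨ La-≥ n (suc k) k ⟩
  ι (La n O₆)                          ∎
  where
  open ℚ.≤-Reasoning
  a  = ι (n C k)
  r  = recip (suc k)
  s  = Q k * Σ₁ k summand
  g  = evolve k increment (2^- suc k)
  p  = spanProb (suc k) k
  p′ = spanProb (suc k) (suc k)

archimedean : ∀ ε → 0ℚ < ε → ∃[ K ] ∀ {k} → K ℕ.≤ k → recip (suc k) ≤ ε
archimedean (ℚ.mkℚ (+ zero)     _ _) (ℚ.*<* (ℤ.+<+ ()))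
archimedean (ℚ.mkℚ ℤ.-[1+ _ ]   _ _) (ℚ.*<* ())
-- The field `d` is the denominator minus one, so ε is at least 1/(d+1).
archimedean ε@(ℚ.mkℚ (+ suc p) d _) _ = d , λ {k} d≤k → ℚ.toℚᵘ-cancel-≤
  (ℚᵘ.≤-respˡ-≃ (ℚᵘ.≃-sym (toℚᵘ-/ (+ 1) (suc k)))
    (ℚᵘ.*≤* (ℤ.+≤+ (ℕ.*-mono-≤ {1} {suc p} (s≤s z≤n) (s≤s d≤k)))))

Σ₁-summand-mono : ∀ i J → Σ₁ J summand ≤ Σ₁ (i ℕ.+ J) summand
Σ₁-summand-mono zero    J = ℚ.≤-refl
Σ₁-summand-mono (suc i) J = ℚ.≤-trans (Σ₁-summand-mono i J)
  (subst (_≤ Σ₁ (suc i ℕ.+ J) summand) (ℚ.+-identityʳ _)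
    (ℚ.+-monoʳ-≤ (Σ₁ (i ℕ.+ J) summand) (summand≥0 (i ℕ.+ J))))

c>0·22 : c >ᴿ fromℚ (+ 22 / 100)
-- Cutting at 4 gives about 0.2203, which leaves room for the margin 1/10000; the same estimate cut
-- at 3 gives only about 0.2193.
c>0·22 = + 1 / 10000 , ℚ.positive⁻¹ _ , 4 , bound
  where
  open ℚ.≤-Reasoning
  Σ₁≥0 : ∀ m → 0ℚ ≤ Σ₁ m summand
  Σ₁≥0 m = subst (λ k → 0ℚ ≤ Σ₁ k summand) (ℕ.+-identityʳ m) (Σ₁-summand-mono m 0)
  bound : ∀ m → 4 ℕ.≤ m → + 22 / 100 + + 1 / 10000 ≤ ℝ.seq c m
  bound m 4≤m = begin
    + 22 / 100 + + 1 / 10000                        ≤⟨ toWitness {a? = _ ℚ.≤? _} _ ⟩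
    (Q 4 * (1ℚ - 2^- 4)) * Σ₁ 4 summand             ≤⟨ *-monoʳ (Σ₁≥0 4) (Q-tail (m ℕ.∸ 4) 4) ⟩
    Q (m ℕ.∸ 4 ℕ.+ 4) * Σ₁ 4 summand                ≤⟨ *-monoˡ (Q≥0 (m ℕ.∸ 4 ℕ.+ 4)) (Σ₁-summand-mono (m ℕ.∸ 4) 4) ⟩
    Q (m ℕ.∸ 4 ℕ.+ 4) * Σ₁ (m ℕ.∸ 4 ℕ.+ 4) summand  ≡⟨ cong (λ k → Q k * Σ₁ k summand) (ℕ.m∸n+n≡m 4≤m) ⟩
    Q m * Σ₁ m summand                              ∎

⌊n/2⌋+⌊n/2⌋≤n : ∀ n → ⌊ n /2⌋ ℕ.+ ⌊ n /2⌋ ℕ.≤ n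
⌊n/2⌋+⌊n/2⌋≤n n = subst (⌊ n /2⌋ ℕ.+ ⌊ n /2⌋ ℕ.≤_) (ℕ.⌊n/2⌋+⌈n/2⌉≡n n)
  (ℕ.+-monoʳ-≤ ⌊ n /2⌋ (ℕ.⌊n/2⌋≤⌈n/2⌉ n))

error : ℕ → ℚ
error k = recip (suc k) + recip (suc k)

-- Subtracting `c` makes 1 + c + o(n) agree at every index with the rational that `La-bound`
-- provides for k = ⌊n/2⌋.
remainder : ℕ → ℝ
remainder n = fromℚ (ℝ.seq c ⌊ n /2⌋ - error ⌊ n /2⌋) -ᴿ c

remainder-⟶0 : remainder ⟶ fromℕ 0
remainder-⟶0 ε ε>0 =
  let K , small = archimedean h h>0
      N , close = ℝ.cauchy c h h>0
      M = K ℕ.⊔ N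
  in M ℕ.+ M , λ n 2M≤n →
    let M≤⌊n/2⌋ = subst (ℕ._≤ ⌊ n /2⌋) (sym (ℕ.n≡⌊n+n/2⌋ M)) (ℕ.⌊n/2⌋-mono 2M≤n)
    in h , h>0 , N , λ m N≤m →
      estimate (ℝ.seq c ⌊ n /2⌋) (ℝ.seq c m) (recip (suc ⌊ n /2⌋))
        (ℚ.<⇒≤ (recip>0 (suc ⌊ n /2⌋)))
        (small (ℕ.≤-trans (ℕ.m≤m⊔n K N) M≤⌊n/2⌋))
        (ℚ.<⇒≤ (close (ℕ.≤-trans (ℕ.m≤n⊔m K N) M≤⌊n/2⌋) N≤m))
  where
  open ℚ.≤-Reasoning
  -- One quarter for the distance between two terms of `c`, two for `error`, and one for the margin
  -- that `<ᴿ` demands.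
  h = (+ 1 / 4) * ε
  h>0 : 0ℚ < h
  h>0 = *->0 (ℚ.positive⁻¹ (+ 1 / 4)) ε>0
  estimate : ∀ x y r → 0ℚ ≤ r → r ≤ h → ℚ.∣ x - y ∣ ≤ h →
             ℚ.∣ ((x - (r + r)) - y) - 0ℚ ∣ + h ≤ ε
  estimate x y r r≥0 r≤h close = begin
    ℚ.∣ ((x - (r + r)) - y) - 0ℚ ∣ + h
      ≡⟨ cong (λ z → ℚ.∣ z ∣ + h) (solve 3 (λ x y r → ((x :- (r :+ r)) :- y) :- con 0ℚ := (x :- y) :- (r :+ r)) refl x y r) ⟩
    ℚ.∣ (x - y) - (r + r) ∣ + h
      ≤⟨ ℚ.+-monoˡ-≤ h (ℚ.∣p-q∣≤∣p∣+∣q∣ (x - y) (r + r)) ⟩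
    (ℚ.∣ x - y ∣ + ℚ.∣ r + r ∣) + h
      ≡⟨ cong (λ z → (ℚ.∣ x - y ∣ + z) + h) (ℚ.0≤p⇒∣p∣≡p (ℚ.+-mono-≤ r≥0 r≥0)) ⟩
    (ℚ.∣ x - y ∣ + (r + r)) + h
      ≤⟨ ℚ.+-monoˡ-≤ h (ℚ.+-mono-≤ close (ℚ.+-mono-≤ r≤h r≤h)) ⟩
    (h + (h + h)) + h
      ≡⟨ solve 1 (λ e → (con (+ 1 / 4) :* e :+ (con (+ 1 / 4) :* e :+ con (+ 1 / 4) :* e)) :+ con (+ 1 / 4) :* e := e) refl ε ⟩
    ε ∎

La-≥-remainder : ∀ n → fromℕ (La n O₆) ≥ᴿ (fromℕ 1 +ᴿ c +ᴿ remainder n) *ᴿ fromℕ (n C ⌊ n /2⌋)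
La-≥-remainder n ε ε>0 = 0 , λ m _ → begin
  ((1ℚ + ℝ.seq c m) + ((x - e) - ℝ.seq c m)) * b
    ≡⟨ solve 4 (λ y x e b → ((con 1ℚ :+ y) :+ ((x :- e) :- y)) :* b := (con 1ℚ :+ (x :- e)) :* b) refl (ℝ.seq c m) x e b ⟩
  (1ℚ + (x - e)) * b              ≤⟨ La-bound n k (⌊n/2⌋+⌊n/2⌋≤n n) ⟩
  ι (La n O₆)                     ≡⟨ ℚ.+-identityʳ (ι (La n O₆)) ⟨
  ι (La n O₆) + 0ℚ                ≤⟨ ℚ.+-monoʳ-≤ (ι (La n O₆)) (ℚ.<⇒≤ ε>0) ⟩
  ι (La n O₆) + ε                 ∎
  where
  open ℚ.≤-Reasoning
  k = ⌊ n /2⌋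
  x = ℝ.seq c k
  e = error k
  b = ι (n C k)

theorem1 : (Σ[ o ∈ (ℕ → ℝ) ]
    (o ⟶ fromℕ 0) ×
    (∀ n → fromℕ (La n O₆) ≥ᴿ (fromℕ 1 +ᴿ c +ᴿ o n) *ᴿ fromℕ (n C ⌊ n /2⌋)))
    × (c >ᴿ fromℚ (+ 22 / 100))
theorem1 = (remainder , remainder-⟶0 , La-≥-remainder) , c>0·22
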